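{- Let $\Sigma,\mathcal R$ be a super-consistent theory and let $t$ be a term well-typed in a context $\Gamma$ in the $\lambda\Pi$-calculus modulo $\Sigma,\mathcal R$. Then $t$ strongly terminates, i.e. there is no infinite $\beta$-reduction sequence $t\longrightarrow^1_\beta t_1\longrightarrow^1_\beta t_2\longrightarrow^1_\beta\cdots$ issued from $t$.
   Context: **Terms.** Terms are $t ::= x\mid Type\mid Kind\mid \Pi x:t\;t\mid\lambda x:t\;t\mid t\,t$, up to $\alpha$-equivalence; $(u/x)t$ is capture-avoiding substitution; $A\to B$ is $\Pi x:A\;B$ with $x$ not free in $B$. $\beta$ is root $\beta$-reduction. For a relation $r$ on terms, $\longrightarrow^1_r$ is its closure under term formation, $\longrightarrow^*_r$ the reflexive-transitive closure of $\longrightarrow_r^1$, and $\equiv_r$ its reflexive-symmetric-transitive closure. **Theories.** A rewrite rule is a triple $l\longrightarrow^{\Gamma}r$ with $\Gamma$ a context and $l,r$ $\beta$-normal; it is well-typed in a context $\Sigma$ if, in the $\lambda\Pi$-calculus, $\Sigma,\Gamma$ is well-formed and $l,r$ have a common type $A$ in $\Sigma,\Gamma$. A theory $\Sigma,\mathcal R$ is a context $\Sigma$ well-formed in the $\lambda\Pi$-calculus (its variables are called constants) and a set $\mathcal R$ of rewrite rules well-typed in $\Sigma$. $t\,\mathcal R\,u$ (root reduction) means $t=\theta l$, $u=\theta r$ for some rule $l\longrightarrow^\Gamma r$ and substitution $\theta$ of the variables of $\Gamma$. $\beta\mathcal R$ is the union of $\beta$ and $\mathcal R$. **Typing in the $\lambda\Pi$-calculus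 modulo $\Sigma,\mathcal R$.** (Empty) $[\,]$ is well-formed. (Declaration) if $\Gamma\vdash A:Type$ or $\Gamma\vdash A:Kind$, and $x\notin\Sigma,\Gamma$, then $\Gamma,x:A$ is well-formed. (Sort) if $\Gamma$ is well-formed, $\Gamma\vdash Type:Kind$. (Variable) if $\Gamma$ is well-formed and $x:A\in\Sigma,\Gamma$ then $\Gamma\vdash x:A$. For $s\in\{Type,Kind\}$: (Product) if $\Gamma\vdash A:Type$ and $\Gamma,x:A\vdash B:s$ then $\Gamma\vdash\Pi x:A\;B:s$; (Abstraction) if moreover $\Gamma,x:A\vdash t:B$ then $\Gamma\vdash\lambda x:A\;t:\Pi x:A\;B$. (Application) if $\Gamma\vdash t:\Pi x:A\;B$ and $\Gamma\vdash u:A$ then $\Gamma\vdash(t\,u):(u/x)B$. (Conversion) for $s\in\{Type,Kind\}$, if $\Gamma\vdash A:s$, $\Gamma\vdash B:s$, $\Gamma\vdash t:A$ and $A\equiv_{\beta\mathcal R}B$ then $\Gamma\vdash t:B$. The plain $\lambda\Pi$-calculus is the case where $\Sigma$ and $\mathcal R$ are empty. Throughout, $\longrightarrow^1_{\beta\mathcal R}$ is assumed confluent and to have the subject reduction property. **$\Pi$-algebras.** A $\Pi$-algebra is a set $\mathcal B$ with a pre-order $\le$, an element $\tilde\top$, a function $\tilde\wedge:\mathcal B\times\mathcal B\to\mathcal B$, a subset $\mathcal A$ of the set $\mathcal P^+(\mathcal B)$ of non-empty subsets of $\mathcal B$, and a function $\tilde\Pi:\mathcal B\times\mathcal A\to\mathcal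 B$, such that $a\le\tilde\top$ for all $a$; $a\,\tilde\wedge\,b$ is a greatest lower bound of $\{a,b\}$; and $a\le\tilde\Pi(b,S)$ iff $a\,\tilde\wedge\,b\le c$ for all $c\in S$. It is full if $\mathcal A=\mathcal P^+(\mathcal B)$. It is ordered if equipped with an order relation $\sqsubseteq$ on $\mathcal B$ such that $a\sqsubseteq b$ implies $\tilde\Pi(b,S)\sqsubseteq\tilde\Pi(a,S)$ for all $S$, and $S\sqsubseteq T$ implies $\tilde\Pi(a,S)\sqsubseteq\tilde\Pi(a,T)$ for all $a$, where $S\sqsubseteq T$ means that for all $a\in S$ there is $b\in T$ with $a\sqsubseteq b$. An ordered $\Pi$-algebra is complete if every subset of $\mathcal B$ has a least upper bound for $\sqsubseteq$. **Models.** A model is a family $\mathcal D^1,\dots,\mathcal D^n$ ($n\ge2$) of functions. $\mathcal D^i$ maps each term $t$ of type $B$ in some context $\Gamma$ (in the calculus modulo $\Sigma,\mathcal R$), and valuations $\phi_1,\dots,\phi_{i-1}$, where $\phi_j$ maps each $x:A$ of $\Gamma$ to an element of $\mathcal D^j_{A,\phi_1,\dots,\phi_{j-1}}$, to some $\mathcal D^i_{t,\phi_1,\dots,\phi_{i-1}}$, which for $i\ge2$ lies in $\mathcal D^{i-1}_{B,\phi_1,\dots,\phi_{i-2}}$; the functions are also defined on $Kind$ (without membership condition). The value depends only on $t$ and on the values of the valuations on variables free in $t$. Write $\llbracket t\rrbracket_{\phi_1,\dots,\phi_{n-1}}$ for $\mathcal D^n_{t,\phi_1,\dots,\phi_{n-1}}$.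 It is required that, for all $t,u$ and valuations (with $u$ of the declared type of $x$), $$\llbracket(u/x)t\rrbracket_{\phi_1,\dots,\phi_{n-1}}=\llbracket t\rrbracket_{(\phi_1,x=\mathcal D^1_u),\dots,(\phi_{n-1},x=\mathcal D^{n-1}_{u,\phi_1,\dots,\phi_{n-2}})}.$$ The model is valued in $\mathcal B$ if $\mathcal D^{n-1}_{Kind,\phi_1,\dots,\phi_{n-2}}=\mathcal D^{n-1}_{Type,\phi_1,\dots,\phi_{n-2}}=\mathcal B$, $\llbracket Kind\rrbracket_{\overline\phi}=\llbracket Type\rrbracket_{\overline\phi}=\tilde\top$, and $$\llbracket\Pi x:C\;D\rrbracket_{\overline\phi}=\tilde\Pi(\llbracket C\rrbracket_{\overline\phi},\{\llbracket D\rrbracket_{(\phi_1,x=c_1),\dots,(\phi_{n-1},x=c_{n-1})}\mid c_1\in\mathcal D^1_C,\dots,c_{n-1}\in\mathcal D^{n-1}_{C,\phi_1,\dots,\phi_{n-2}}\}).$$ A model valued in $\mathcal B$ is a model of $\Sigma,\mathcal R$ if $\llbracket A\rrbracket\ge\tilde\top$ for every constant $c:A$ in $\Sigma$, and for all $A,B$ well-typed in a context $\Gamma$ with $A\equiv_{\beta\mathcal R}B$, all $i$ and all valuations $\overline\phi$, $\mathcal D^i_{A,\overline\phi}=\mathcal D^i_{B,\overline\phi}$. **Super-consistency.** A theory $\Sigma,\mathcal R$ is super-consistent if, for every full, ordered and complete $\Pi$-algebra $\mathcal B$, there exists a model of $\Sigma,\mathcal R$ valued in $\mathcal B$.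
   Formalization: In the substitution condition for models, x takes the values D^{j+1}_u (j=1..n-1) instead of the ill-typed D^j_u; the sets in which valuations take values are required to be non-empty, which is automatic unless Σ is empty. -}

module Defs where

open import Level using (0ℓ)
open import Algebra.Core using (Op₂)
open import Algebra.Definitions using (Congruent₂)
open import Data.Fin using (Fin; fromℕ; inject₁; _↑ˡ_)
open import Data.List using (List; []; _∷_; _++_; map)
open import Data.List.Membership.Propositional using (_∈_; _∉_)
open import Data.List.Relation.Unary.All using (All)
open import Data.Nat using (ℕ; suc; _+_; _≤_; _≟_)
open import Data.Product using (_×_; _,_; ∃; ∃-syntax; proj₁)
open import Data.Sum using (_⊎_)
open import Data.Unit using (⊤)
open import Data.Vec using (Vec; []; _∷_; zipWith)
open import Data.Vec.Relation.Binary.Pointwise.Inductive using (Pointwise)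
open import Function using (_⇔_)
open import Relation.Binary.Construct.Closure.Equivalence using (EqClosure)
open import Relation.Binary.Construct.Union using (_∪_)
open import Relation.Binary.Core using (Rel)
open import Relation.Binary.Definitions using (Maximum; _Respects_)
open import Relation.Binary.Lattice using (Infimum)
open import Relation.Binary.PropositionalEquality using (_≡_)
open import Relation.Binary.Rewriting using (IsNormalForm)
open import Relation.Binary.Structures using (IsPreorder; IsPartialOrder)
open import Relation.Nullary using (¬_; yes; no)
open import Relation.Unary using (Pred)
import Relation.Unary as U

Var : Set
Var = ℕ

data Sort : Set where
  type kind : Sort

-- Terms up to α-equivalence, in locally nameless form: free variables (and
-- constants) are named, bound variables are de Bruijn indices.  Tm n has n
-- dangling indices; the terms of the calculus are the elements of Tm 0.
data Tm (n : ℕ) : Set where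
  fvar : Var → Tm n
  bvar : Fin n → Tm n
  sort : Sort → Tm n
  pi   : Tm n → Tm (suc n) → Tm n
  lam  : Tm n → Tm (suc n) → Tm n
  app  : Tm n → Tm n → Tm n

Term : Set
Term = Tm 0

pattern Type = sort type
pattern Kind = sort kind

fv : ∀ {n} → Tm n → List Var
fv (fvar x)  = x ∷ []
fv (bvar i)  = []
fv (sort s)  = []
fv (pi A B)  = fv A ++ fv B
fv (lam A t) = fv A ++ fv t
fv (app t u) = fv t ++ fv u

-- abs x t turns the free variable x into a new, outermost, dangling index;
-- this is why no existing index has to be shifted.
abs : ∀ {n} → Var → Tm n → Tm (suc n)
abs {n} x (fvar y) with x ≟ y
... | yes _ = bvar (fromℕ n)
... | no  _ = fvar y
abs x (bvar i)  = bvar (inject₁ i)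
abs x (sort s)  = sort s
abs x (pi A B)  = pi (abs x A) (abs x B)
abs x (lam A t) = lam (abs x A) (abs x t)
abs x (app t u) = app (abs x t) (abs x u)

infix 8 Π[_∶_]_ ƛ[_∶_]_

Π[_∶_]_ : Var → Term → Term → Term
Π[ x ∶ A ] B = pi A (abs x B)

ƛ[_∶_]_ : Var → Term → Term → Term
ƛ[ x ∶ A ] t = lam A (abs x t)

weaken : ∀ {m} n → Tm m → Tm (m + n)
weaken n (fvar x)  = fvar x
weaken n (bvar i)  = bvar (i ↑ˡ n)
weaken n (sort s)  = sort s
weaken n (pi A B)  = pi (weaken n A) (weaken n B)
weaken n (lam A t) = lam (weaken n A) (weaken n t)
weaken n (app t u) = app (weaken n t) (weaken n u)

Substitution : Set
Substitution = Var → Term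

infix 9 _⟪_⟫ _[_/_]

_⟪_⟫ : ∀ {n} → Tm n → Substitution → Tm n
_⟪_⟫ {n} (fvar x) θ = weaken n (θ x)
bvar i  ⟪ θ ⟫ = bvar i
sort s  ⟪ θ ⟫ = sort s
pi A B  ⟪ θ ⟫ = pi (A ⟪ θ ⟫) (B ⟪ θ ⟫)
lam A t ⟪ θ ⟫ = lam (A ⟪ θ ⟫) (t ⟪ θ ⟫)
app t u ⟪ θ ⟫ = app (t ⟪ θ ⟫) (u ⟪ θ ⟫)

_[_/_] : Term → Term → Var → Term
t [ u / x ] = t ⟪ θ ⟫
  where
  θ : Substitution
  θ y with x ≟ y
  ... | yes _ = u
  ... | no  _ = fvar y

data β : Rel Term 0ℓ where
  beta : ∀ {x A t u} → β (app (ƛ[ x ∶ A ] t) u) (t [ u / x ])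

-- The most recent declaration comes first, so the concatenation
-- written Σ,Γ on paper is Γ ++ Σ.
Context : Set
Context = List (Var × Term)

infixl 5 _▸_∶_
pattern _▸_∶_ Γ x A = (x , A) ∷ Γ

dom : Context → List Var
dom = map proj₁

-- Closure of a relation under term formation.  Bound variables are chosen
-- distinct from the constants, which are the variables of Σ: otherwise
-- α-equivalence would let a rewrite rule about a constant c apply to a bound
-- variable, through Π[ c ∶ A ] B.
data Step (Σ : Context) (r : Rel Term 0ℓ) : Rel Term 0ℓ where
  root : ∀ {t u} → r t u → Step Σ r t u
  pi₁  : ∀ {x A A′ B} → x ∉ dom Σ → Step Σ r A A′ →
         Step Σ r (Π[ x ∶ A ] B) (Π[ x ∶ A′ ] B)
  pi₂  : ∀ {x A B B′} → x ∉ dom Σ → Step Σ r B B′ →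
         Step Σ r (Π[ x ∶ A ] B) (Π[ x ∶ A ] B′)
  lam₁ : ∀ {x A A′ t} → x ∉ dom Σ → Step Σ r A A′ →
         Step Σ r (ƛ[ x ∶ A ] t) (ƛ[ x ∶ A′ ] t)
  lam₂ : ∀ {x A t t′} → x ∉ dom Σ → Step Σ r t t′ →
         Step Σ r (ƛ[ x ∶ A ] t) (ƛ[ x ∶ A ] t′)
  app₁ : ∀ {t t′ u} → Step Σ r t t′ → Step Σ r (app t u) (app t′ u)
  app₂ : ∀ {t u u′} → Step Σ r u u′ → Step Σ r (app t u) (app t u′)

-- β is stable under renaming, so no constants need to be avoided.
_⟶β_ : Rel Term 0ℓ
_⟶β_ = Step [] β

StronglyTerminates : Term → Set
StronglyTerminates t =
  ¬ (∃ λ (s : ℕ → Term) → s 0 ≡ t × (∀ k → s k ⟶β s (suc k)))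

record RewriteRule : Set where
  field
    ctx        : Context
    lhs rhs    : Term
    lhs-normal : IsNormalForm _⟶β_ lhs
    rhs-normal : IsNormalForm _⟶β_ rhs

Rules : Set₁
Rules = Pred RewriteRule 0ℓ

data Rewrite (ℛ : Rules) : Rel Term 0ℓ where
  rewr : ∀ {ρ} → ℛ ρ → let open RewriteRule ρ in
         (θ : Substitution) → (∀ x → x ∉ dom ctx → θ x ≡ fvar x) →
         Rewrite ℛ (lhs ⟪ θ ⟫) (rhs ⟪ θ ⟫)

module Calculus (Σ : Context) (ℛ : Rules) where

  infix 3 _⊢_∶_
  infix 4 _⟶βℛ_ _≡βℛ_

  _⟶βℛ_ : Rel Term 0ℓ
  _⟶βℛ_ = Step Σ (β ∪ Rewrite ℛ)

  _≡βℛ_ : Rel Term 0ℓ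
  _≡βℛ_ = EqClosure _⟶βℛ_

  data WellFormed : Context → Set
  data _⊢_∶_ : Context → Term → Term → Set

  data WellFormed where
    empty : WellFormed []
    decl  : ∀ {Γ x A s} → Γ ⊢ A ∶ sort s → x ∉ dom (Γ ++ Σ) →
            WellFormed (Γ ▸ x ∶ A)

  data _⊢_∶_ where
    sort-rule : ∀ {Γ} → WellFormed Γ → Γ ⊢ Type ∶ Kind
    variable-rule : ∀ {Γ x A} → WellFormed Γ → (x , A) ∈ Γ ++ Σ →
                    Γ ⊢ fvar x ∶ A
    product : ∀ {Γ x A B s} → Γ ⊢ A ∶ Type → Γ ▸ x ∶ A ⊢ B ∶ sort s →
              Γ ⊢ Π[ x ∶ A ] B ∶ sort s
    abstraction : ∀ {Γ x A B t s} →
                  Γ ⊢ A ∶ Type → Γ ▸ x ∶ A ⊢ B ∶ sort s → Γ ▸ x ∶ A ⊢ t ∶ B →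
                  Γ ⊢ ƛ[ x ∶ A ] t ∶ Π[ x ∶ A ] B
    application : ∀ {Γ x A B t u} → Γ ⊢ t ∶ Π[ x ∶ A ] B → Γ ⊢ u ∶ A →
                  Γ ⊢ app t u ∶ B [ u / x ]
    conversion : ∀ {Γ A B t s} →
                 Γ ⊢ A ∶ sort s → Γ ⊢ B ∶ sort s → Γ ⊢ t ∶ A → A ≡βℛ B →
                 Γ ⊢ t ∶ B

  WellTyped : Context → Term → Set
  WellTyped Γ t = ∃[ A ] (Γ ⊢ t ∶ A)

  SubjectReduction : Set
  SubjectReduction = ∀ {Γ t u A} → Γ ⊢ t ∶ A → t ⟶βℛ u → Γ ⊢ u ∶ A

module λΠ = Calculus [] U.∅

record WellTypedRule (Σ : Context) (ρ : RewriteRule) : Set where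
  open RewriteRule ρ
  field
    ctx-wf     : λΠ.WellFormed (ctx ++ Σ)
    commonType : Term
    lhs-typed  : ctx ++ Σ λΠ.⊢ lhs ∶ commonType
    rhs-typed  : ctx ++ Σ λΠ.⊢ rhs ∶ commonType

record IsTheory (Σ : Context) (ℛ : Rules) : Set where
  field
    Σ-wf    : λΠ.WellFormed Σ
    ℛ-typed : ∀ {ρ} → ℛ ρ → WellTypedRule Σ ρ

-- Aczel's cumulative hierarchy over the small types, with extensional
-- equality _≈_ and membership _ϵ_: the universe of sets in which models take
-- their values.

data 𝕍 : Set₁ where
  set : (I : Set) → (I → 𝕍) → 𝕍

infix 4 _≈_ _ϵ_

_≈_ : 𝕍 → 𝕍 → Set
set I f ≈ set J g =
  (∀ i → ∃[ j ] (f i ≈ g j)) × (∀ j → ∃[ i ] (f i ≈ g j))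

_ϵ_ : 𝕍 → 𝕍 → Set
a ϵ set I f = ∃[ i ] (a ≈ f i)

-- The elements of a set, as a setoid (El 𝓑 , Eq 𝓑).
El : 𝕍 → Set
El (set I f) = I

elem : (𝓑 : 𝕍) → El 𝓑 → 𝕍
elem (set I f) i = f i

Eq : (𝓑 : 𝕍) → Rel (El 𝓑) 0ℓ
Eq 𝓑 a b = elem 𝓑 a ≈ elem 𝓑 b

record Subset (𝓑 : 𝕍) : Set₁ where
  field
    pred     : Pred (El 𝓑) 0ℓ
    respects : pred Respects Eq 𝓑

open Subset public

Nonempty : ∀ {𝓑} → Subset 𝓑 → Set
Nonempty S = ∃[ a ] pred S a

record ΠAlgebra : Set₁ where
  field
    𝓑  : 𝕍
    _≲_ : Rel (El 𝓑) 0ℓ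
    ⊤̃   : El 𝓑
    _∧̃_ : Op₂ (El 𝓑)
    𝒜  : Pred (Subset 𝓑) 0ℓ
    Π̃   : El 𝓑 → (S : Subset 𝓑) → 𝒜 S → El 𝓑

    -- 𝒜, ∧̃ and Π̃ are compatible with the equality of sets.
    𝒜-resp : ∀ {S T} → pred S U.≐ pred T → 𝒜 S → 𝒜 T
    ∧̃-cong : Congruent₂ (Eq 𝓑) _∧̃_
    Π̃-cong : ∀ {a b S T} (p : 𝒜 S) (q : 𝒜 T) →
             Eq 𝓑 a b → pred S U.≐ pred T → Eq 𝓑 (Π̃ a S p) (Π̃ b T q)

    𝒜⊆𝒫⁺       : ∀ {S} → 𝒜 S → Nonempty S
    isPreorder : IsPreorder (Eq 𝓑) _≲_
    ⊤̃-max      : Maximum _≲_ ⊤̃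
    ∧̃-inf      : Infimum _≲_ _∧̃_
    Π̃-adj      : ∀ a b {S} (p : 𝒜 S) →
                 (a ≲ Π̃ b S p) ⇔ (∀ c → pred S c → (a ∧̃ b) ≲ c)

Full : ΠAlgebra → Set₁
Full 𝔅 = ∀ S → Nonempty S → 𝒜 S
  where open ΠAlgebra 𝔅

record Ordering (𝔅 : ΠAlgebra) : Set₁ where
  open ΠAlgebra 𝔅
  field
    _⊑_ : Rel (El 𝓑) 0ℓ

  _⊑ₛ_ : Rel (Subset 𝓑) 0ℓ
  S ⊑ₛ T = ∀ a → pred S a → ∃[ b ] (pred T b × a ⊑ b)

  field
    isPartialOrder : IsPartialOrder (Eq 𝓑) _⊑_
    Π̃-antitone     : ∀ {a b S} (p : 𝒜 S) → a ⊑ b → Π̃ b S p ⊑ Π̃ a S p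
    Π̃-monotone     : ∀ {a S T} (p : 𝒜 S) (q : 𝒜 T) → S ⊑ₛ T →
                     Π̃ a S p ⊑ Π̃ a T q

Complete : ∀ {𝔅} → Ordering 𝔅 → Set₁
Complete {𝔅} order = (S : Subset 𝓑) →
  ∃[ b ] ((∀ a → pred S a → a ⊑ b) ×
          (∀ c → (∀ a → pred S a → a ⊑ c) → b ⊑ c))
  where
  open ΠAlgebra 𝔅
  open Ordering order

Valuation : Set₁
Valuation = Var → 𝕍

-- A tuple φ₁,…,φₖ is stored with φₖ at the head.
Valuations : ℕ → Set₁
Valuations = Vec Valuation

infixl 9 _[_↦_]
_[_↦_] : ∀ {k} → Valuations k → Var → Vec 𝕍 k → Valuations k
φs [ x ↦ cs ] = zipWith update φs cs
  where
  update : Valuation → 𝕍 → Valuation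
  update φ c y with x ≟ y
  ... | yes _ = c
  ... | no  _ = φ y

-- 𝒟 k t (φₖ ∷ … ∷ φ₁ ∷ []) is 𝒟^{k+1}_{t,φ₁,…,φₖ}.  A family of such
-- functions is given as total functions, all of whose conditions below are
-- restricted to the arguments on which they have to be defined.
Family : Set₁
Family = (k : ℕ) → Term → Valuations k → 𝕍

module _ (𝒟 : Family) where

  -- φⱼ maps each x : A of Γ to an element of 𝒟^j_{A,φ₁,…,φⱼ₋₁}.
  On : ∀ {k} → Context → Valuations k → Set
  On Γ []       = ⊤
  On Γ (φ ∷ φs) = On Γ φs × (∀ {x A} → (x , A) ∈ Γ → φ x ϵ 𝒟 _ A φs)

  -- cⱼ ∈ 𝒟^j_{A,φ₁,…,φⱼ₋₁} for each j.
  Elements : ∀ {k} → Term → Valuations k → Vec 𝕍 k → Set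
  Elements A []       []       = ⊤
  Elements A (φ ∷ φs) (c ∷ cs) = Elements A φs cs × c ϵ 𝒟 _ A φs

  -- The tuple of elements of the 𝒟^j_{A,φ₁,…,φⱼ₋₁} determined by a term u
  -- of type A.  The element of 𝒟^j_A which u determines is
  -- 𝒟^{j+1}_{u,φ₁,…,φⱼ}, and not 𝒟^j_u.
  values : ∀ {k} → Term → Valuations k → Vec 𝕍 k
  values u []       = []
  values u (φ ∷ φs) = 𝒟 _ u (φ ∷ φs) ∷ values u φs

module Semantics (Σ : Context) (ℛ : Rules) where
  open Calculus Σ ℛ

  Interpretable : Context → Term → Set
  Interpretable Γ t = WellTyped Γ t ⊎ t ≡ Kind

  -- A model 𝒟^1,…,𝒟^n with n = m + 2.
  record Model : Set₁ where
    field
      m : ℕ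
      𝒟 : Family

    ⟦_⟧ : Term → Valuations (suc m) → 𝕍
    ⟦_⟧ = 𝒟 (suc m)

    field
      typed : ∀ {k Γ t B φ} {φs : Valuations k} → k ≤ m →
              Γ ⊢ t ∶ B → On 𝒟 Γ (φ ∷ φs) →
              𝒟 (suc k) t (φ ∷ φs) ϵ 𝒟 k B φs

      -- The value depends only on the term and on the valuations of its free
      -- variables; constants are not valuated.
      local : ∀ {k Γ Δ t} {φs ψs : Valuations k} → k ≤ suc m →
              Interpretable Γ t → Interpretable Δ t →
              On 𝒟 Γ φs → On 𝒟 Δ ψs →
              (∀ x → x ∈ fv t → x ∉ dom Σ →
                Pointwise (λ φ ψ → φ x ≈ ψ x) φs ψs) →
              𝒟 k t φs ≈ 𝒟 k t ψs

      -- The sets in which valuations take their values are non-empty.  For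
      -- A : Type this is forced by 𝒜 ⊆ 𝒫⁺(𝓑) in the clause for products
      -- below, and for A : Kind it is automatic as soon as Σ is non-empty,
      -- because Σ then contains a closed type.
      inhabited : ∀ {k Γ A s} {φs : Valuations k} → k ≤ m →
                  Γ ⊢ A ∶ sort s → On 𝒟 Γ φs → ∃[ c ] (c ϵ 𝒟 k A φs)

      substitution : ∀ {Γ x A t u} {φs : Valuations (suc m)} →
                     Interpretable (Γ ▸ x ∶ A) t → Γ ⊢ u ∶ A → On 𝒟 Γ φs →
                     ⟦ t [ u / x ] ⟧ φs ≈ ⟦ t ⟧ (φs [ x ↦ values 𝒟 u φs ])

  record ValuedIn (𝔅 : ΠAlgebra) (ℳ : Model) : Set₁ where
    open ΠAlgebra 𝔅
    open Model ℳ
    field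
      𝒟-Kind : ∀ φs → 𝒟 m Kind φs ≈ 𝓑
      𝒟-Type : ∀ φs → 𝒟 m Type φs ≈ 𝓑
      ⟦Kind⟧ : ∀ φs → ⟦ Kind ⟧ φs ≈ elem 𝓑 ⊤̃
      ⟦Type⟧ : ∀ φs → ⟦ Type ⟧ φs ≈ elem 𝓑 ⊤̃

      -- In particular the set S of the values of D has to belong to 𝒜, as Π̃
      -- is only defined there.
      ⟦Π⟧ : ∀ {Γ x C D s φs} →
            Γ ⊢ C ∶ Type → Γ ▸ x ∶ C ⊢ D ∶ sort s → On 𝒟 Γ φs →
            ∃[ b ] ∃[ S ] ∃[ p ]
              (⟦ C ⟧ φs ≈ elem 𝓑 b ×
               (∀ d → pred S d ⇔
                  (∃[ cs ] (Elements 𝒟 C φs cs ×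
                            ⟦ D ⟧ (φs [ x ↦ cs ]) ≈ elem 𝓑 d))) ×
               ⟦ Π[ x ∶ C ] D ⟧ φs ≈ elem 𝓑 (Π̃ b S p))

  record ModelsTheory (𝔅 : ΠAlgebra) (ℳ : Model) : Set₁ where
    open ΠAlgebra 𝔅
    open Model ℳ
    field
      constants  : ∀ {c A} → (c , A) ∈ Σ → ∀ φs →
                   ∃[ a ] (⟦ A ⟧ φs ≈ elem 𝓑 a × ⊤̃ ≲ a)
      congruence : ∀ {k Γ A B} {φs : Valuations k} → k ≤ suc m →
                   WellTyped Γ A → WellTyped Γ B → A ≡βℛ B →
                   On 𝒟 Γ φs → 𝒟 k A φs ≈ 𝒟 k B φs

  SuperConsistent : Set₁
  SuperConsistent =
    (𝔅 : ΠAlgebra) → Full 𝔅 → (order : Ordering 𝔅) → Complete order →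
    ∃[ ℳ ] (ValuedIn 𝔅 ℳ × ModelsTheory 𝔅 ℳ)

{-# OPTIONS --safe #-}

-- Super-consistency is applied to the Π-algebra of Girard's reducibility
-- candidates, with Π̃ a S the set of the t such that t u lies in every element of
-- S for all u in a.  In the model obtained, a term in context Γ, under a
-- substitution which maps each x : A to an element of ⟦A⟧, belongs to the
-- candidate interpreting its type, by induction on the typing derivation; and
-- every candidate contains only strongly terminating terms and all variables.
-- Excluded middle turns predicates on terms into Boolean functions, which makes
-- the candidates a small type and hence a set of 𝕍.

module Submission where

open import Defs
open import Level using (0ℓ)
open import Axiom.ExcludedMiddle using (ExcludedMiddle)
open import Relation.Binary.Rewriting using (Confluent)
open import Data.Bool using (Bool; T)
open import Data.Empty using (⊥; ⊥-elim)
open import Data.Fin using (Fin; zero; suc; inject₁; toℕ; _↑ˡ_)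
open import Data.Fin.Properties using (toℕ-injective)
open import Data.Fin.Relation.Unary.Top using (‵fromℕ; ‵inject₁; view; view-fromℕ; view-inject₁)
open import Data.List using (List; []; _∷_; _++_)
open import Data.List.Extrema.Nat using (max; xs≤max)
open import Data.List.Membership.Propositional using (_∈_; _∉_)
open import Data.List.Membership.Propositional.Properties using (∈-++⁺ˡ; ∈-++⁺ʳ; ∈-++⁻; ∈-map⁺)
open import Data.List.Properties using (map-++; ++-identityʳ)
open import Data.List.Relation.Binary.Subset.Propositional using (_⊆_)
open import Data.List.Relation.Unary.All using (lookup)
open import Data.List.Relation.Unary.Any using (here; there)
open import Data.Nat using (ℕ; zero; suc; _≤_; _≟_; s≤s⁻¹)
open import Data.List.Membership.DecPropositional _≟_ using (_∈?_)
open import Data.Nat.Binary using (ℕᵇ; 2[1+_]; 1+[2_]) renaming (toℕ to ℕᵇ-toℕ; zero to zeroᵇ)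
open import Data.Nat.Binary.Properties using () renaming (toℕ-injective to ℕᵇ-toℕ-injective)
open import Data.Nat.Properties using (1+n≰n; ≤-refl; m≤n⇒m≤1+n)
open import Data.Product using (_×_; _,_; ∃; ∃-syntax; proj₁; proj₂)
open import Data.Sum using (_⊎_; inj₁; inj₂)
open import Data.Unit using (⊤; tt)
open import Data.Vec using (Vec; []; _∷_; zipWith; replicate)
open import Data.Vec.Relation.Binary.Pointwise.Inductive using (Pointwise; []; _∷_)
open import Function using (Equivalence; _∘_; flip; id; mk⇔)
open import Induction.WellFounded using (Acc; acc)
open import Relation.Binary.Construct.Closure.Equivalence using (gmap)
open import Relation.Binary.Construct.Union using (_∪_)
open import Relation.Binary.Core using (Rel)
open import Relation.Binary.PropositionalEquality
open import Relation.Nullary using (yes; no)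
open import Relation.Nullary.Decidable using (⌊_⌋; toWitness; fromWitness)
import Relation.Unary as U

-- Every rule reaches the body of a binder through a name and `abs`, so a substitution that crosses
-- a binder would have to choose a new name each time. `inst` undoes `abs` without any name, and
-- soundness under a binder is stated for instances of the nameless body `abs x t ⟪ σ ⟫`.
--
-- The product clause of a model speaks only of products whose domain and codomain are well typed.
-- At an application, the type of the function must therefore be shown to be sorted, and the
-- codomain must remain sorted when the argument is substituted. This is what the typing metatheory
-- serves.

private
  variable
    l n k : ℕ

-- Syntax

lift : (Fin l → Fin n) → Fin (suc l) → Fin (suc n)
lift f zero    = zero
lift f (suc i) = suc (f i)

ren : (Fin l → Fin n) → Tm l → Tm n
ren f (fvar x)  = fvar x
ren f (bvar i)  = bvar (f i)
ren f (sort s)  = sort s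
ren f (pi A B)  = pi (ren f A) (ren (lift f) B)
ren f (lam A t) = lam (ren f A) (ren (lift f) t)
ren f (app t u) = app (ren f t) (ren f u)

lift-cong : {f g : Fin l → Fin n} → f ≗ g → lift f ≗ lift g
lift-cong e zero    = refl
lift-cong e (suc i) = cong suc (e i)

ren-cong : {f g : Fin l → Fin n} → f ≗ g → ren f ≗ ren g
ren-cong e (fvar x)  = refl
ren-cong e (bvar i)  = cong bvar (e i)
ren-cong e (sort s)  = refl
ren-cong e (pi A B)  = cong₂ pi (ren-cong e A) (ren-cong (lift-cong e) B)
ren-cong e (lam A t) = cong₂ lam (ren-cong e A) (ren-cong (lift-cong e) t)
ren-cong e (app t u) = cong₂ app (ren-cong e t) (ren-cong e u)

ren-closed : (f g : Fin 0 → Fin n) (t : Term) → ren f t ≡ ren g t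
ren-closed f g = ren-cong λ ()

lift-id : {f : Fin n → Fin n} → f ≗ (λ i → i) → lift f ≗ (λ i → i)
lift-id e zero    = refl
lift-id e (suc i) = cong suc (e i)

ren-id : {f : Fin n → Fin n} → f ≗ (λ i → i) → (t : Tm n) → ren f t ≡ t
ren-id e (fvar x)  = refl
ren-id e (bvar i)  = cong bvar (e i)
ren-id e (sort s)  = refl
ren-id e (pi A B)  = cong₂ pi (ren-id e A) (ren-id (lift-id e) B)
ren-id e (lam A t) = cong₂ lam (ren-id e A) (ren-id (lift-id e) t)
ren-id e (app t u) = cong₂ app (ren-id e t) (ren-id e u)

lift-∘ : (f : Fin n → Fin k) (g : Fin l → Fin n) → lift f ∘ lift g ≗ lift (f ∘ g)
lift-∘ f g zero    = refl
lift-∘ f g (suc i) = refl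

ren-∘ : (f : Fin n → Fin k) (g : Fin l → Fin n) (t : Tm l) →
        ren f (ren g t) ≡ ren (f ∘ g) t
ren-∘ f g (fvar x)  = refl
ren-∘ f g (bvar i)  = refl
ren-∘ f g (sort s)  = refl
ren-∘ f g (pi A B)  =
  cong₂ pi (ren-∘ f g A) (trans (ren-∘ _ _ B) (ren-cong (lift-∘ f g) B))
ren-∘ f g (lam A t) =
  cong₂ lam (ren-∘ f g A) (trans (ren-∘ _ _ t) (ren-cong (lift-∘ f g) t))
ren-∘ f g (app t u) = cong₂ app (ren-∘ f g t) (ren-∘ f g u)

↑ˡ-lift : ∀ n (i : Fin (suc l)) → i ↑ˡ n ≡ lift (_↑ˡ n) i
↑ˡ-lift n zero    = refl
↑ˡ-lift n (suc i) = refl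

weaken≡ren : ∀ n (t : Tm l) → weaken n t ≡ ren (_↑ˡ n) t
weaken≡ren n (fvar x)  = refl
weaken≡ren n (bvar i)  = refl
weaken≡ren n (sort s)  = refl
weaken≡ren n (pi A B)  =
  cong₂ pi (weaken≡ren n A) (trans (weaken≡ren n B) (ren-cong (↑ˡ-lift n) B))
weaken≡ren n (lam A t) =
  cong₂ lam (weaken≡ren n A) (trans (weaken≡ren n t) (ren-cong (↑ˡ-lift n) t))
weaken≡ren n (app t u) = cong₂ app (weaken≡ren n t) (weaken≡ren n u)

weaken-closed : (f : Fin 0 → Fin n) (t : Term) → weaken n t ≡ ren f t
weaken-closed {n} f t = trans (weaken≡ren n t) (ren-closed _ f t)

weaken-0 : (t : Term) → weaken 0 t ≡ t
weaken-0 t = trans (weaken-closed (λ i → i) t) (ren-id (λ _ → refl) t)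

ren-weaken : (f : Fin l → Fin n) (t : Term) → ren f (weaken l t) ≡ weaken n t
ren-weaken {l} {n} f t = begin
  ren f (weaken l t)        ≡⟨ cong (ren f) (weaken≡ren l t) ⟩
  ren f (ren (_↑ˡ l) t)     ≡⟨ ren-∘ f _ t ⟩
  ren (λ i → f (i ↑ˡ l)) t  ≡⟨ weaken-closed _ t ⟨
  weaken n t                ∎
  where open ≡-Reasoning

-- inst u instantiates the outermost dangling index, the one which abs creates.
inst : Term → Tm (suc n) → Tm n
inst u (fvar x) = fvar x
inst {n} u (bvar i) with view i
... | ‵fromℕ     = weaken n u
... | ‵inject₁ j = bvar j
inst u (sort s)  = sort s
inst u (pi A B)  = pi (inst u A) (inst u B)
inst u (lam A t) = lam (inst u A) (inst u t)
inst u (app t v) = app (inst u t) (inst u v)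

lift-inject₁ : {f : Fin l → Fin (suc n)} {g : Fin l → Fin n} →
               f ≗ inject₁ ∘ g → lift f ≗ inject₁ ∘ lift g
lift-inject₁ e zero    = refl
lift-inject₁ e (suc i) = cong suc (e i)

-- A renaming that factors through `inject₁` misses the outermost index, so `inst` finds nothing to
-- replace.
inst-ren : {f : Fin l → Fin (suc n)} {g : Fin l → Fin n} (u : Term) →
           f ≗ inject₁ ∘ g → (t : Tm l) → inst u (ren f t) ≡ ren g t
inst-ren u e (fvar x) = refl
inst-ren {g = g} u e (bvar i)
  rewrite e i | view-inject₁ (g i) = refl
inst-ren u e (sort s) = refl
inst-ren u e (pi A B) = cong₂ pi (inst-ren u e A) (inst-ren u (lift-inject₁ e) B)
inst-ren u e (lam A t) = cong₂ lam (inst-ren u e A) (inst-ren u (lift-inject₁ e) t)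
inst-ren u e (app t v) = cong₂ app (inst-ren u e t) (inst-ren u e v)

inst-weaken : ∀ n (u t : Term) → inst u (weaken (suc n) t) ≡ weaken n t
inst-weaken n u t = begin
  inst u (weaken (suc n) t)                 ≡⟨ cong (inst u) (weaken-closed _ t) ⟩
  inst u (ren (inject₁ ∘ (_↑ˡ n)) t)        ≡⟨ inst-ren u (λ _ → refl) t ⟩
  ren (_↑ˡ n) t                             ≡⟨ weaken≡ren n t ⟨
  weaken n t                                ∎
  where open ≡-Reasoning

infixl 9 _⟨_≔_⟩
_⟨_≔_⟩ : Substitution → Var → Term → Substitution
(θ ⟨ x ≔ u ⟩) y with x ≟ y
... | yes _ = u
... | no  _ = θ y

≔-same : ∀ θ x u → (θ ⟨ x ≔ u ⟩) x ≡ u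
≔-same θ x u with x ≟ x
... | yes _  = refl
... | no x≢x = ⊥-elim (x≢x refl)

≔-other : ∀ θ {x y} u → x ≢ y → (θ ⟨ x ≔ u ⟩) y ≡ θ y
≔-other θ {x} {y} u x≢y with x ≟ y
... | yes x≡y = ⊥-elim (x≢y x≡y)
... | no _    = refl

⟪⟫-cong-fv : ∀ {θ θ′} (t : Tm n) → (∀ x → x ∈ fv t → θ x ≡ θ′ x) → t ⟪ θ ⟫ ≡ t ⟪ θ′ ⟫
⟪⟫-cong-fv (fvar x)  e = cong (weaken _) (e x (here refl))
⟪⟫-cong-fv (bvar i)  e = refl
⟪⟫-cong-fv (sort s)  e = refl
⟪⟫-cong-fv (pi A B)  e =
  cong₂ pi (⟪⟫-cong-fv A λ x → e x ∘ ∈-++⁺ˡ) (⟪⟫-cong-fv B λ x → e x ∘ ∈-++⁺ʳ (fv A))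
⟪⟫-cong-fv (lam A t) e =
  cong₂ lam (⟪⟫-cong-fv A λ x → e x ∘ ∈-++⁺ˡ) (⟪⟫-cong-fv t λ x → e x ∘ ∈-++⁺ʳ (fv A))
⟪⟫-cong-fv (app t u) e =
  cong₂ app (⟪⟫-cong-fv t λ x → e x ∘ ∈-++⁺ˡ) (⟪⟫-cong-fv u λ x → e x ∘ ∈-++⁺ʳ (fv t))

⟪⟫-cong : ∀ {θ θ′} (t : Tm n) → θ ≗ θ′ → t ⟪ θ ⟫ ≡ t ⟪ θ′ ⟫
⟪⟫-cong t e = ⟪⟫-cong-fv t λ x _ → e x

⟪⟫-id : (t : Tm n) → t ⟪ fvar ⟫ ≡ t
⟪⟫-id (fvar x)  = refl
⟪⟫-id (bvar i)  = refl
⟪⟫-id (sort s)  = refl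
⟪⟫-id (pi A B)  = cong₂ pi (⟪⟫-id A) (⟪⟫-id B)
⟪⟫-id (lam A t) = cong₂ lam (⟪⟫-id A) (⟪⟫-id t)
⟪⟫-id (app t u) = cong₂ app (⟪⟫-id t) (⟪⟫-id u)

ren-⟪⟫ : (f : Fin l → Fin n) (θ : Substitution) (t : Tm l) →
         (ren f t) ⟪ θ ⟫ ≡ ren f (t ⟪ θ ⟫)
ren-⟪⟫ f θ (fvar x)  = sym (ren-weaken f (θ x))
ren-⟪⟫ f θ (bvar i)  = refl
ren-⟪⟫ f θ (sort s)  = refl
ren-⟪⟫ f θ (pi A B)  = cong₂ pi (ren-⟪⟫ f θ A) (ren-⟪⟫ (lift f) θ B)
ren-⟪⟫ f θ (lam A t) = cong₂ lam (ren-⟪⟫ f θ A) (ren-⟪⟫ (lift f) θ t)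
ren-⟪⟫ f θ (app t u) = cong₂ app (ren-⟪⟫ f θ t) (ren-⟪⟫ f θ u)

weaken-⟪⟫ : ∀ n (θ : Substitution) (t : Term) → weaken n t ⟪ θ ⟫ ≡ weaken n (t ⟪ θ ⟫)
weaken-⟪⟫ n θ t = begin
  weaken n t ⟪ θ ⟫        ≡⟨ cong _⟪ θ ⟫ (weaken≡ren n t) ⟩
  ren (_↑ˡ n) t ⟪ θ ⟫     ≡⟨ ren-⟪⟫ (_↑ˡ n) θ t ⟩
  ren (_↑ˡ n) (t ⟪ θ ⟫)   ≡⟨ weaken≡ren n (t ⟪ θ ⟫) ⟨
  weaken n (t ⟪ θ ⟫)      ∎
  where open ≡-Reasoning

⟪⟫-⟪⟫ : ∀ θ θ′ (t : Tm n) → t ⟪ θ ⟫ ⟪ θ′ ⟫ ≡ t ⟪ (λ x → θ x ⟪ θ′ ⟫) ⟫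
⟪⟫-⟪⟫ θ θ′ (fvar x)  = weaken-⟪⟫ _ θ′ (θ x)
⟪⟫-⟪⟫ θ θ′ (bvar i)  = refl
⟪⟫-⟪⟫ θ θ′ (sort s)  = refl
⟪⟫-⟪⟫ θ θ′ (pi A B)  = cong₂ pi (⟪⟫-⟪⟫ θ θ′ A) (⟪⟫-⟪⟫ θ θ′ B)
⟪⟫-⟪⟫ θ θ′ (lam A t) = cong₂ lam (⟪⟫-⟪⟫ θ θ′ A) (⟪⟫-⟪⟫ θ θ′ t)
⟪⟫-⟪⟫ θ θ′ (app t u) = cong₂ app (⟪⟫-⟪⟫ θ θ′ t) (⟪⟫-⟪⟫ θ θ′ u)

-- No freshness of `x` is required: the values of `θ` are closed terms, so the index made by `abs`
-- cannot occur in them, and a free `x` in them is not affected either.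
inst-abs-⟪⟫ : ∀ u x θ (t : Tm n) → inst u (abs x t ⟪ θ ⟫) ≡ t ⟪ θ ⟨ x ≔ u ⟩ ⟫
inst-abs-⟪⟫ {n} u x θ (fvar y) with x ≟ y
... | yes refl rewrite view-fromℕ n = refl
... | no  _    = inst-weaken n u (θ y)
inst-abs-⟪⟫ u x θ (bvar i) rewrite view-inject₁ i = refl
inst-abs-⟪⟫ u x θ (sort s)  = refl
inst-abs-⟪⟫ u x θ (pi A B)  = cong₂ pi (inst-abs-⟪⟫ u x θ A) (inst-abs-⟪⟫ u x θ B)
inst-abs-⟪⟫ u x θ (lam A t) = cong₂ lam (inst-abs-⟪⟫ u x θ A) (inst-abs-⟪⟫ u x θ t)
inst-abs-⟪⟫ u x θ (app t v) = cong₂ app (inst-abs-⟪⟫ u x θ t) (inst-abs-⟪⟫ u x θ v)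

-- The mutual block makes Agda infer from /≡≔ the substitution local to the
-- definition of _[_/_], which has no name, before it checks /≗≔.
mutual
  /≡≔ : ∀ x (t u : Term) → t [ u / x ] ≡ t ⟪ fvar ⟨ x ≔ u ⟩ ⟫
  /≡≔ x t u = ⟪⟫-cong t (/≗≔ x t u)

  /≗≔ : ∀ x (t u : Term) y → _ ≡ (fvar ⟨ x ≔ u ⟩) y
  /≗≔ x t u y with x ≟ y
  ... | yes _ = refl
  ... | no  _ = refl

inst-abs : ∀ u x (t : Term) → inst u (abs x t) ≡ t [ u / x ]
inst-abs u x t = begin
  inst u (abs x t)              ≡⟨ cong (inst u) (⟪⟫-id (abs x t)) ⟨
  inst u (abs x t ⟪ fvar ⟫)     ≡⟨ inst-abs-⟪⟫ u x fvar t ⟩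
  t ⟪ fvar ⟨ x ≔ u ⟩ ⟫          ≡⟨ /≡≔ x t u ⟨
  t [ u / x ]                   ∎
  where open ≡-Reasoning

-- Freshness keeps `abs` from also capturing occurrences of `x` that were already in `t`.
abs-inst : ∀ x (t : Tm (suc n)) → x ∉ fv t → abs x (inst (fvar x) t) ≡ t
abs-inst x (fvar y) x∉ with x ≟ y
... | yes refl = ⊥-elim (x∉ (here refl))
... | no _     = refl
abs-inst x (bvar i) x∉ with view i
... | ‵inject₁ j = refl
... | ‵fromℕ with x ≟ x
...   | yes _  = refl
...   | no x≢x = ⊥-elim (x≢x refl)
abs-inst x (sort s)  x∉ = refl
abs-inst x (pi A B)  x∉ =
  cong₂ pi (abs-inst x A (x∉ ∘ ∈-++⁺ˡ)) (abs-inst x B (x∉ ∘ ∈-++⁺ʳ (fv A)))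
abs-inst x (lam A t) x∉ =
  cong₂ lam (abs-inst x A (x∉ ∘ ∈-++⁺ˡ)) (abs-inst x t (x∉ ∘ ∈-++⁺ʳ (fv A)))
abs-inst x (app t u) x∉ =
  cong₂ app (abs-inst x t (x∉ ∘ ∈-++⁺ˡ)) (abs-inst x u (x∉ ∘ ∈-++⁺ʳ (fv t)))

fv-abs⁻ : ∀ x (t : Tm n) {y} → y ∈ fv (abs x t) → y ∈ fv t × x ≢ y
fv-abs⁻ x (fvar z) y∈ with x ≟ z
fv-abs⁻ x (fvar z) (here refl) | no x≢z = here refl , x≢z
fv-abs⁻ x (pi A B)  y∈ with ∈-++⁻ (fv (abs x A)) y∈
... | inj₁ p = let q , x≢y = fv-abs⁻ x A p in ∈-++⁺ˡ q , x≢y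
... | inj₂ p = let q , x≢y = fv-abs⁻ x B p in ∈-++⁺ʳ (fv A) q , x≢y
fv-abs⁻ x (lam A t) y∈ with ∈-++⁻ (fv (abs x A)) y∈
... | inj₁ p = let q , x≢y = fv-abs⁻ x A p in ∈-++⁺ˡ q , x≢y
... | inj₂ p = let q , x≢y = fv-abs⁻ x t p in ∈-++⁺ʳ (fv A) q , x≢y
fv-abs⁻ x (app t u) y∈ with ∈-++⁻ (fv (abs x t)) y∈
... | inj₁ p = let q , x≢y = fv-abs⁻ x t p in ∈-++⁺ˡ q , x≢y
... | inj₂ p = let q , x≢y = fv-abs⁻ x u p in ∈-++⁺ʳ (fv t) q , x≢y

fresh : (xs : List Var) → ∃[ x ] x ∉ xs
fresh xs = suc (max 0 xs) , λ x∈ → 1+n≰n (lookup (xs≤max 0 xs) x∈)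

-- Renaming of the bound variable: it puts a substituted body back into the form `abs y _` that the
-- constructors of `Step` and of typing require.
abs-⟪⟫ : ∀ x y θ (t : Term) → y ∉ fv (abs x t ⟪ θ ⟫) →
         abs x t ⟪ θ ⟫ ≡ abs y (t ⟪ θ ⟨ x ≔ fvar y ⟩ ⟫)
abs-⟪⟫ x y θ t y∉ = begin
  abs x t ⟪ θ ⟫                        ≡⟨ abs-inst y _ y∉ ⟨
  abs y (inst (fvar y) (abs x t ⟪ θ ⟫)) ≡⟨ cong (abs y) (inst-abs-⟪⟫ (fvar y) x θ t) ⟩
  abs y (t ⟪ θ ⟨ x ≔ fvar y ⟩ ⟫)       ∎
  where open ≡-Reasoning

-- Closure under substitution

infix 4 _Fixes_
-- Constants are free variables of the rewrite rules, so rewriting is stable only under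
-- substitutions that leave them alone.
_Fixes_ : Substitution → List Var → Set
θ Fixes xs = ∀ {c} → c ∈ xs → θ c ≡ fvar c

Fixes-≔ : ∀ {θ x u xs} → θ Fixes xs → x ∉ xs → θ ⟨ x ≔ u ⟩ Fixes xs
Fixes-≔ {θ} {x} {u} θ-fix x∉ c∈ = trans (≔-other θ {x} u λ { refl → x∉ c∈ }) (θ-fix c∈)

module _ {Σ₁ Σ₂ : Context} {r₁ r₂ : Rel Term 0ℓ}
         (root-⟪⟫ : ∀ {t u θ} → θ Fixes dom Σ₁ → r₁ t u → r₂ (t ⟪ θ ⟫) (u ⟪ θ ⟫)) where

  Step-⟪⟫ : ∀ {t u θ} → θ Fixes dom Σ₁ → Step Σ₁ r₁ t u → Step Σ₂ r₂ (t ⟪ θ ⟫) (u ⟪ θ ⟫)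
  Step-⟪⟫ θ-fix (root p) = root (root-⟪⟫ θ-fix p)
  Step-⟪⟫ {θ = θ} θ-fix (pi₁ {x} {B = B} _ p)
    with y , y∉ ← fresh (dom Σ₂ ++ fv (abs x B ⟪ θ ⟫))
    rewrite abs-⟪⟫ x y θ B (y∉ ∘ ∈-++⁺ʳ (dom Σ₂)) =
    pi₁ {B = B ⟪ θ ⟨ x ≔ fvar y ⟩ ⟫} (y∉ ∘ ∈-++⁺ˡ) (Step-⟪⟫ θ-fix p)
  Step-⟪⟫ {θ = θ} θ-fix (lam₁ {x} {t = t} _ p)
    with y , y∉ ← fresh (dom Σ₂ ++ fv (abs x t ⟪ θ ⟫))
    rewrite abs-⟪⟫ x y θ t (y∉ ∘ ∈-++⁺ʳ (dom Σ₂)) =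
    lam₁ {t = t ⟪ θ ⟨ x ≔ fvar y ⟩ ⟫} (y∉ ∘ ∈-++⁺ˡ) (Step-⟪⟫ θ-fix p)
  Step-⟪⟫ {θ = θ} θ-fix (pi₂ {x} {B = B} {B′} x∉ p)
    with y , y∉ ← fresh (dom Σ₂ ++ fv (abs x B ⟪ θ ⟫) ++ fv (abs x B′ ⟪ θ ⟫))
    rewrite abs-⟪⟫ x y θ B (y∉ ∘ ∈-++⁺ʳ (dom Σ₂) ∘ ∈-++⁺ˡ)
          | abs-⟪⟫ x y θ B′ (y∉ ∘ ∈-++⁺ʳ (dom Σ₂) ∘ ∈-++⁺ʳ (fv (abs x B ⟪ θ ⟫))) =
    pi₂ (y∉ ∘ ∈-++⁺ˡ) (Step-⟪⟫ (Fixes-≔ θ-fix x∉) p)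
  Step-⟪⟫ {θ = θ} θ-fix (lam₂ {x} {t = t} {t′} x∉ p)
    with y , y∉ ← fresh (dom Σ₂ ++ fv (abs x t ⟪ θ ⟫) ++ fv (abs x t′ ⟪ θ ⟫))
    rewrite abs-⟪⟫ x y θ t (y∉ ∘ ∈-++⁺ʳ (dom Σ₂) ∘ ∈-++⁺ˡ)
          | abs-⟪⟫ x y θ t′ (y∉ ∘ ∈-++⁺ʳ (dom Σ₂) ∘ ∈-++⁺ʳ (fv (abs x t ⟪ θ ⟫))) =
    lam₂ (y∉ ∘ ∈-++⁺ˡ) (Step-⟪⟫ (Fixes-≔ θ-fix x∉) p)
  Step-⟪⟫ θ-fix (app₁ p) = app₁ (Step-⟪⟫ θ-fix p)
  Step-⟪⟫ θ-fix (app₂ p) = app₂ (Step-⟪⟫ θ-fix p)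

/-⟪⟫ : ∀ x (t u : Term) θ → (t [ u / x ]) ⟪ θ ⟫ ≡ t ⟪ θ ⟨ x ≔ u ⟪ θ ⟫ ⟩ ⟫
/-⟪⟫ x t u θ = begin
  (t [ u / x ]) ⟪ θ ⟫                           ≡⟨ cong _⟪ θ ⟫ (/≡≔ x t u) ⟩
  t ⟪ fvar ⟨ x ≔ u ⟩ ⟫ ⟪ θ ⟫                    ≡⟨ ⟪⟫-⟪⟫ (fvar ⟨ x ≔ u ⟩) θ t ⟩
  t ⟪ (λ y → (fvar ⟨ x ≔ u ⟩) y ⟪ θ ⟫) ⟫        ≡⟨ ⟪⟫-cong t pointwise ⟩
  t ⟪ θ ⟨ x ≔ u ⟪ θ ⟫ ⟩ ⟫                       ∎
  where
  open ≡-Reasoning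
  pointwise : ∀ y → (fvar ⟨ x ≔ u ⟩) y ⟪ θ ⟫ ≡ (θ ⟨ x ≔ u ⟪ θ ⟫ ⟩) y
  pointwise y with x ≟ y
  ... | yes _ = refl
  ... | no  _ = weaken-0 (θ y)

/-⟪⟫-inst : ∀ x (t u : Term) θ → (t [ u / x ]) ⟪ θ ⟫ ≡ inst (u ⟪ θ ⟫) (abs x t ⟪ θ ⟫)
/-⟪⟫-inst x t u θ = trans (/-⟪⟫ x t u θ) (sym (inst-abs-⟪⟫ (u ⟪ θ ⟫) x θ t))

-- Any name fresh for `t` exhibits `t` as an `abs`, which frees contraction from the name of the
-- bound variable.
β-inst : ∀ {A : Term} (t : Tm 1) (u : Term) → β (app (lam A t) u) (inst u t)
β-inst {A} t u =
  subst₂ (λ t′ v → β (app (lam A t′) u) v) t≡ (trans (sym (inst-abs u x t₀)) (cong (inst u) t≡))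
    (beta {x} {A} {t₀})
  where
  x = proj₁ (fresh (fv t))
  t₀ = inst (fvar x) t
  t≡ : abs x t₀ ≡ t
  t≡ = abs-inst x t (proj₂ (fresh (fv t)))

β-⟪⟫ : ∀ {t u θ} → β t u → β (t ⟪ θ ⟫) (u ⟪ θ ⟫)
β-⟪⟫ {θ = θ} (beta {x} {A} {t} {u}) =
  subst (β _) (sym (/-⟪⟫-inst x t u θ)) (β-inst (abs x t ⟪ θ ⟫) (u ⟪ θ ⟫))

-- Typing

dom-++⁺ʳ : ∀ Γ {Δ} → dom Δ ⊆ dom (Γ ++ Δ)
dom-++⁺ʳ Γ {Δ} x∈ = subst (_ ∈_) (sym (map-++ proj₁ Γ Δ)) (∈-++⁺ʳ (dom Γ) x∈)

dom-++⁻ : ∀ Γ {Δ x} → x ∈ dom (Γ ++ Δ) → x ∈ dom Γ ⊎ x ∈ dom Δ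
dom-++⁻ Γ {Δ} x∈ = ∈-++⁻ (dom Γ) (subst (_ ∈_) (map-++ proj₁ Γ Δ) x∈)

Closed : Context → Set
Closed Γ = ∀ {x A} → (x , A) ∈ Γ → fv A ⊆ dom Γ

module _ {Σ : Context} {ℛ : Rules} where
  open Calculus Σ ℛ

  wf : ∀ {Γ t A} → Γ ⊢ t ∶ A → WellFormed Γ
  wf (sort-rule Γ-wf)       = Γ-wf
  wf (variable-rule Γ-wf _) = Γ-wf
  wf (product ⊢A _)         = wf ⊢A
  wf (abstraction ⊢A _ _)   = wf ⊢A
  wf (application ⊢t _)     = wf ⊢t
  wf (conversion _ _ ⊢t _)  = wf ⊢t

  fv-⊢ : ∀ {Γ t A} → Γ ⊢ t ∶ A → fv t ⊆ dom (Γ ++ Σ)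
  fv-binder : ∀ {Γ x A B C} → Γ ▸ x ∶ A ⊢ B ∶ C → fv (abs x B) ⊆ dom (Γ ++ Σ)

  fv-⊢ (variable-rule _ x∈) (here refl) = ∈-map⁺ proj₁ x∈
  fv-⊢ (product {A = A} ⊢A ⊢B) y∈ with ∈-++⁻ (fv A) y∈
  ... | inj₁ p = fv-⊢ ⊢A p
  ... | inj₂ p = fv-binder ⊢B p
  fv-⊢ (abstraction {A = A} ⊢A _ ⊢t) y∈ with ∈-++⁻ (fv A) y∈
  ... | inj₁ p = fv-⊢ ⊢A p
  ... | inj₂ p = fv-binder ⊢t p
  fv-⊢ (application {t = t} ⊢t ⊢u) y∈ with ∈-++⁻ (fv t) y∈
  ... | inj₁ p = fv-⊢ ⊢t p
  ... | inj₂ p = fv-⊢ ⊢u p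
  fv-⊢ (conversion _ _ ⊢t _) = fv-⊢ ⊢t

  fv-binder {x = x} {B = B} ⊢B y∈ with fv-abs⁻ x B y∈
  ... | p , x≢y with fv-⊢ ⊢B p
  ...   | here refl = ⊥-elim (x≢y refl)
  ...   | there q   = q

  wf-closed : ∀ {Γ} → Closed Σ → WellFormed Γ → Closed (Γ ++ Σ)
  wf-closed Σ-closed empty x∈ = Σ-closed x∈
  wf-closed Σ-closed (decl ⊢A _) (here refl) = there ∘ fv-⊢ ⊢A
  wf-closed Σ-closed (decl ⊢A _) (there x∈)  = there ∘ wf-closed Σ-closed (wf ⊢A) x∈

  -- A product type that has been substituted into comes without a bound name; any name fresh for
  -- `T` serves the rule.
  application-inst : ∀ {Γ A T t u} → Γ ⊢ t ∶ pi A T → Γ ⊢ u ∶ A → Γ ⊢ app t u ∶ inst u T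
  application-inst {Γ} {A} {T} {t} {u} ⊢t ⊢u
    with x , x∉ ← fresh (fv T) =
    subst (λ B → Γ ⊢ app t u ∶ B) (trans (sym (inst-abs u x (inst (fvar x) T))) (cong (inst u) T≡))
      (application {x = x} {B = inst (fvar x) T} (subst (λ T → Γ ⊢ t ∶ pi A T) (sym T≡) ⊢t) ⊢u)
    where T≡ = abs-inst x T x∉

  Π-inversion : ∀ {Γ A T U} → Γ ⊢ pi A T ∶ U →
    ∃[ x ] ∃[ B ] ∃[ s ] (T ≡ abs x B × Γ ⊢ A ∶ Type × Γ ▸ x ∶ A ⊢ B ∶ sort s)
  Π-inversion (product ⊢A ⊢B)       = _ , _ , _ , refl , ⊢A , ⊢B
  Π-inversion (conversion _ _ ⊢T _) = Π-inversion ⊢T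

⟪≔⟫-fresh : ∀ {θ x u xs} (t : Term) → x ∉ xs → fv t ⊆ xs → t ⟪ θ ⟨ x ≔ u ⟩ ⟫ ≡ t ⟪ θ ⟫
⟪≔⟫-fresh {θ} {x} {u} t x∉ fv⊆ = ⟪⟫-cong-fv t λ y y∈ → ≔-other θ {x} u λ { refl → x∉ (fv⊆ y∈) }

-- Source and target theories are kept apart because the types of constants are typed in the plain
-- calculus, where the earlier constants form the context, and have to be carried to the calculus
-- modulo, where `Σ` stands outside the context.
module TypingSubstitution
  (Σ₁ : Context) (ℛ₁ : Rules) (Σ₂ : Context) (ℛ₂ : Rules)
  (Σ₁-closed : Closed Σ₁)
  (root-⟪⟫ : ∀ {t u θ} → θ Fixes dom Σ₁ →
             (β ∪ Rewrite ℛ₁) t u → (β ∪ Rewrite ℛ₂) (t ⟪ θ ⟫) (u ⟪ θ ⟫))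
  where
  open Calculus Σ₁ ℛ₁ using () renaming (_⊢_∶_ to _⊢₁_∶_; WellFormed to WellFormed₁)
  open Calculus Σ₂ ℛ₂ renaming (_⊢_∶_ to _⊢₂_∶_; WellFormed to WellFormed₂)

  -- V is instantiated first with declared variables, which proves renaming and
  -- weakening, and then with arbitrary typed terms.
  module _
    (V : Context → Term → Term → Set)
    (V⇒⊢   : ∀ {Δ u A} → WellFormed₂ Δ → V Δ u A → Δ ⊢₂ u ∶ A)
    (V-new  : ∀ {Δ x A} → WellFormed₂ (Δ ▸ x ∶ A) → V (Δ ▸ x ∶ A) (fvar x) A)
    (V-weak : ∀ {Δ x A u B} → WellFormed₂ (Δ ▸ x ∶ A) → V Δ u B → V (Δ ▸ x ∶ A) u B)
    where

    record _⟶⟨_⟩_ (Γ : Context) (θ : Substitution) (Δ : Context) : Set where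
      field
        fixes  : θ Fixes dom Σ₁
        images : ∀ {x A} → (x , A) ∈ Γ ++ Σ₁ → V Δ (θ x) (A ⟪ θ ⟫)
    open _⟶⟨_⟩_

    extend : ∀ {Γ Δ θ x y A} → WellFormed₁ (Γ ▸ x ∶ A) → WellFormed₂ (Δ ▸ y ∶ A ⟪ θ ⟫) →
             Γ ⟶⟨ θ ⟩ Δ → (Γ ▸ x ∶ A) ⟶⟨ θ ⟨ x ≔ fvar y ⟩ ⟩ (Δ ▸ y ∶ A ⟪ θ ⟫)
    fixes (extend {Γ} {θ = θ} {x} (decl _ x∉) _ θ∶) =
      Fixes-≔ {θ} {x} (fixes θ∶) (x∉ ∘ dom-++⁺ʳ Γ)
    images (extend {Γ} {Δ} {θ} {x} {y} {A} (decl ⊢A x∉) Δ-wf θ∶) (here refl)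
      rewrite ≔-same θ x (fvar y) | ⟪≔⟫-fresh {θ} {x} {fvar y} A x∉ (fv-⊢ ⊢A) = V-new Δ-wf
    images (extend {Γ} {Δ} {θ} {x} {y} (decl ⊢A x∉) Δ-wf θ∶) {z} {B} (there z∈)
      rewrite ≔-other θ {x} {z} (fvar y) (λ { refl → x∉ (∈-map⁺ proj₁ z∈) })
            | ⟪≔⟫-fresh {θ} {x} {fvar y} B x∉ (wf-closed Σ₁-closed (wf ⊢A) z∈) =
      V-weak Δ-wf (images θ∶ z∈)

    ⊢-⟪⟫ : ∀ {Γ Δ θ t A} → Γ ⊢₁ t ∶ A → WellFormed₂ Δ → Γ ⟶⟨ θ ⟩ Δ →
           Δ ⊢₂ t ⟪ θ ⟫ ∶ A ⟪ θ ⟫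
    ⊢-⟪⟫ (sort-rule _) Δ-wf θ∶ = sort-rule Δ-wf
    ⊢-⟪⟫ {Δ = Δ} {θ} (variable-rule {x = x} {A} _ x∈) Δ-wf θ∶ =
      subst (λ u → Δ ⊢₂ u ∶ A ⟪ θ ⟫) (sym (weaken-0 (θ x))) (V⇒⊢ Δ-wf (images θ∶ x∈))
    ⊢-⟪⟫ {Δ = Δ} {θ} (product {x = x} {A} {B} ⊢A ⊢B) Δ-wf θ∶
      with y , y∉ ← fresh (dom (Δ ++ Σ₂) ++ fv (abs x B ⟪ θ ⟫))
      rewrite abs-⟪⟫ x y θ B (y∉ ∘ ∈-++⁺ʳ (dom (Δ ++ Σ₂))) =
      product ⊢Aθ (⊢-⟪⟫ ⊢B Δ′-wf (extend (wf ⊢B) Δ′-wf θ∶))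
      where
      ⊢Aθ = ⊢-⟪⟫ ⊢A Δ-wf θ∶
      Δ′-wf = decl ⊢Aθ (y∉ ∘ ∈-++⁺ˡ)
    ⊢-⟪⟫ {Δ = Δ} {θ} (abstraction {x = x} {A} {B} {t} ⊢A ⊢B ⊢t) Δ-wf θ∶
      with y , y∉ ← fresh (dom (Δ ++ Σ₂) ++ fv (abs x B ⟪ θ ⟫) ++ fv (abs x t ⟪ θ ⟫))
      rewrite abs-⟪⟫ x y θ B (y∉ ∘ ∈-++⁺ʳ (dom (Δ ++ Σ₂)) ∘ ∈-++⁺ˡ)
            | abs-⟪⟫ x y θ t (y∉ ∘ ∈-++⁺ʳ (dom (Δ ++ Σ₂)) ∘ ∈-++⁺ʳ (fv (abs x B ⟪ θ ⟫))) =
      abstraction ⊢Aθ (⊢-⟪⟫ ⊢B Δ′-wf θ′∶) (⊢-⟪⟫ ⊢t Δ′-wf θ′∶)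
      where
      ⊢Aθ = ⊢-⟪⟫ ⊢A Δ-wf θ∶
      Δ′-wf = decl ⊢Aθ (y∉ ∘ ∈-++⁺ˡ)
      θ′∶ = extend (wf ⊢B) Δ′-wf θ∶
    ⊢-⟪⟫ {θ = θ} (application {x = x} {B = B} {u = u} ⊢t ⊢u) Δ-wf θ∶
      rewrite /-⟪⟫-inst x B u θ =
      application-inst (⊢-⟪⟫ ⊢t Δ-wf θ∶) (⊢-⟪⟫ ⊢u Δ-wf θ∶)
    ⊢-⟪⟫ (conversion ⊢A ⊢B ⊢t A≡B) Δ-wf θ∶ =
      conversion (⊢-⟪⟫ ⊢A Δ-wf θ∶) (⊢-⟪⟫ ⊢B Δ-wf θ∶) (⊢-⟪⟫ ⊢t Δ-wf θ∶)
        (gmap _⟪ _ ⟫ (Step-⟪⟫ root-⟪⟫ (fixes θ∶)) A≡B)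

  Declared : Context → Term → Term → Set
  Declared Δ u A = ∃[ x ] (u ≡ fvar x × (x , A) ∈ Δ ++ Σ₂)

  ⊢-weaken : ∀ {Γ Δ t A} → Γ ⊢₁ t ∶ A → WellFormed₂ Δ → Γ ++ Σ₁ ⊆ Δ ++ Σ₂ → Δ ⊢₂ t ∶ A
  ⊢-weaken {Γ} {Δ} {t} {A} ⊢t Δ-wf Γ⊆Δ =
    subst₂ (λ t A → Δ ⊢₂ t ∶ A) (⟪⟫-id t) (⟪⟫-id A)
      (⊢-⟪⟫ Declared
        (λ { Δ-wf (x , refl , x∈) → variable-rule Δ-wf x∈ })
        (λ _ → _ , refl , here refl)
        (λ { _ (x , refl , x∈) → x , refl , there x∈ })
        ⊢t Δ-wf
        record { fixes  = λ _ → refl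
               ; images = λ {x} {B} x∈ →
                   x , refl , subst (λ B → (x , B) ∈ Δ ++ Σ₂) (sym (⟪⟫-id B)) (Γ⊆Δ x∈) })

-- Substitution and regularity of typing in a theory

module Metatheory {Σ : Context} {ℛ : Rules} (theory : IsTheory Σ ℛ) where
  open Calculus Σ ℛ
  open IsTheory theory

  -- The composite of `θ₀` and `θ` need not be a substitution of the rule's variables, so `θ₁`
  -- restricts it to `dom ctx`. Nothing is lost: by typing, both sides of the rule have their free
  -- variables in `ctx ++ Σ`, and the composite fixes the constants outside `ctx`.
  root-⟪⟫ : ∀ {t u θ} → θ Fixes dom Σ →
            (β ∪ Rewrite ℛ) t u → (β ∪ Rewrite ℛ) (t ⟪ θ ⟫) (u ⟪ θ ⟫)
  root-⟪⟫ θ-fix (inj₁ p) = inj₁ (β-⟪⟫ p)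
  root-⟪⟫ {θ = θ} θ-fix (inj₂ (rewr {ρ} ρ∈ϑ θ₀ θ₀-fix)) =
    inj₂ (subst₂ (Rewrite ℛ) (fuse lhs (fv-⊢ lhs-typed)) (fuse rhs (fv-⊢ rhs-typed))
           (rewr ρ∈ϑ θ₁ θ₁-fix))
    where
    open RewriteRule ρ
    open WellTypedRule (ℛ-typed ρ∈ϑ)
    θ₁ : Substitution
    θ₁ x with x ∈? dom ctx
    ... | yes _ = θ₀ x ⟪ θ ⟫
    ... | no  _ = fvar x
    θ₁-fix : ∀ x → x ∉ dom ctx → θ₁ x ≡ fvar x
    θ₁-fix x x∉ with x ∈? dom ctx
    ... | yes x∈ = ⊥-elim (x∉ x∈)
    ... | no  _  = refl
    agree : ∀ x → x ∈ dom (ctx ++ Σ) → θ₁ x ≡ θ₀ x ⟪ θ ⟫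
    agree x x∈ with x ∈? dom ctx
    ... | yes _ = refl
    ... | no x∉ with dom-++⁻ ctx x∈
    ...   | inj₁ x∈ctx = ⊥-elim (x∉ x∈ctx)
    ...   | inj₂ x∈Σ rewrite θ₀-fix x x∉ =
              sym (trans (weaken-0 (θ x)) (θ-fix x∈Σ))
    fuse : ∀ t → fv t ⊆ dom ((ctx ++ Σ) ++ []) → t ⟪ θ₁ ⟫ ≡ t ⟪ θ₀ ⟫ ⟪ θ ⟫
    fuse t fv⊆ = trans
      (⟪⟫-cong-fv t λ x x∈ → agree x (subst (λ Γ → x ∈ dom Γ) (++-identityʳ (ctx ++ Σ)) (fv⊆ x∈)))
      (sym (⟪⟫-⟪⟫ θ₀ θ t))

  Σ-closed : Closed Σ
  Σ-closed = subst Closed (++-identityʳ Σ) (wf-closed (λ ()) Σ-wf)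

  open TypingSubstitution Σ ℛ Σ ℛ Σ-closed root-⟪⟫

  root-⟪⟫-λΠ : ∀ {t u θ} → θ Fixes [] →
               (β ∪ Rewrite U.∅) t u → (β ∪ Rewrite ℛ) (t ⟪ θ ⟫) (u ⟪ θ ⟫)
  root-⟪⟫-λΠ _ (inj₁ p) = inj₁ (β-⟪⟫ p)
  root-⟪⟫-λΠ _ (inj₂ (rewr () _ _))

  constant-sorted : ∀ {c A} → (c , A) ∈ Σ → ∃[ s ] ([] ⊢ A ∶ sort s)
  constant-sorted = go Σ-wf id
    where
    go : ∀ {Δ c A} → λΠ.WellFormed Δ → Δ ⊆ Σ → (c , A) ∈ Δ → ∃[ s ] ([] ⊢ A ∶ sort s)
    go {Γ ▸ x ∶ A} (decl ⊢A _) Δ⊆Σ (here refl) =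
      _ , TypingSubstitution.⊢-weaken [] U.∅ Σ ℛ (λ ()) root-⟪⟫-λΠ ⊢A empty
            (Δ⊆Σ ∘ there ∘ subst (_ ∈_) (++-identityʳ Γ))
    go (decl ⊢A _) Δ⊆Σ (there c∈) = go (wf ⊢A) (Δ⊆Σ ∘ there) c∈

  declaration-sorted : ∀ {Γ x A} → WellFormed Γ → (x , A) ∈ Γ ++ Σ → ∃[ s ] (Γ ⊢ A ∶ sort s)
  declaration-sorted {Γ} {x} {A} Γ-wf = go Γ-wf id
    where
    go : ∀ {Δ} → WellFormed Δ → Δ ++ Σ ⊆ Γ ++ Σ → (x , A) ∈ Δ ++ Σ → ∃[ s ] (Γ ⊢ A ∶ sort s)
    go empty Δ⊆Γ x∈ = let s , ⊢A = constant-sorted x∈ in s , ⊢-weaken ⊢A Γ-wf Δ⊆Γ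
    go (decl ⊢A _) Δ⊆Γ (here refl) = _ , ⊢-weaken ⊢A Γ-wf (Δ⊆Γ ∘ there)
    go (decl ⊢A _) Δ⊆Γ (there x∈) = go (wf ⊢A) (Δ⊆Γ ∘ there) x∈

  ⊢-/ : ∀ {Γ x A t u B} → Γ ▸ x ∶ A ⊢ t ∶ B → Γ ⊢ u ∶ A → Γ ⊢ t [ u / x ] ∶ B [ u / x ]
  ⊢-/ {Γ} {x} {A} {t} {u} {B} ⊢t ⊢u with decl ⊢A x∉ ← wf ⊢t
    rewrite /≡≔ x t u | /≡≔ x B u =
    ⊢-⟪⟫ _⊢_∶_ (λ _ ⊢v → ⊢v)
      (λ Δ-wf → variable-rule Δ-wf (here refl))
      (λ Δ-wf ⊢v → ⊢-weaken ⊢v Δ-wf there)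
      ⊢t (wf ⊢u) record { fixes = fixes ; images = images }
    where
    unchanged : ∀ C → fv C ⊆ dom (Γ ++ Σ) → C ⟪ fvar ⟨ x ≔ u ⟩ ⟫ ≡ C
    unchanged C fv⊆ = trans (⟪≔⟫-fresh C x∉ fv⊆) (⟪⟫-id C)
    fixes : fvar ⟨ x ≔ u ⟩ Fixes dom Σ
    fixes c∈ = ≔-other fvar {x} u λ { refl → x∉ (dom-++⁺ʳ Γ c∈) }
    images : ∀ {y C} → (y , C) ∈ (Γ ▸ x ∶ A) ++ Σ → Γ ⊢ (fvar ⟨ x ≔ u ⟩) y ∶ C ⟪ fvar ⟨ x ≔ u ⟩ ⟫
    images (here refl) rewrite ≔-same fvar x u | unchanged A (fv-⊢ ⊢A) = ⊢u
    images {y} {C} (there y∈)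
      rewrite ≔-other fvar {x} {y} u (λ { refl → x∉ (∈-map⁺ proj₁ y∈) })
            | unchanged C (wf-closed Σ-closed (wf ⊢A) y∈) =
      variable-rule (wf ⊢A) y∈

  -- `Kind` itself has no type, so it has to be a separate case.
  data IsType (Γ : Context) : Term → Set where
    is-kind : IsType Γ Kind
    sorted  : ∀ {A s} → Γ ⊢ A ∶ sort s → IsType Γ A

  type-of : ∀ {Γ t A} → Γ ⊢ t ∶ A → IsType Γ A
  type-of (sort-rule _) = is-kind
  type-of (variable-rule Γ-wf x∈) = sorted (proj₂ (declaration-sorted Γ-wf x∈))
  type-of (product {s = type} ⊢A ⊢B) = sorted (sort-rule (wf ⊢A))
  type-of (product {s = kind} ⊢A ⊢B) = is-kind
  type-of (abstraction ⊢A ⊢B _) = sorted (product ⊢A ⊢B)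
  type-of {Γ} (application {x = x} {B = B} {u = u} ⊢t ⊢u) with sorted ⊢Π ← type-of ⊢t
    with x′ , B′ , s , abs≡ , _ , ⊢B′ ← Π-inversion ⊢Π =
    sorted (subst (λ C → Γ ⊢ C ∶ sort s) B′[u]≡B[u] (⊢-/ ⊢B′ ⊢u))
    where
    B′[u]≡B[u] : B′ [ u / x′ ] ≡ B [ u / x ]
    B′[u]≡B[u] = trans (sym (inst-abs u x′ B′))
                   (trans (cong (inst u) (sym abs≡)) (inst-abs u x B))
  type-of (conversion _ ⊢B _ _) = sorted ⊢B

-- Sets

≈-refl : ∀ a → a ≈ a
≈-refl (set I f) = (λ i → i , ≈-refl (f i)) , (λ i → i , ≈-refl (f i))

≈-sym : ∀ {a b} → a ≈ b → b ≈ a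
≈-sym {set I f} {set J g} (p , q) =
  (λ j → let i , e = q j in i , ≈-sym e) , (λ i → let j , e = p i in j , ≈-sym e)

≈-trans : ∀ {a b c} → a ≈ b → b ≈ c → a ≈ c
≈-trans {set I f} {set J g} {set K h} (p , q) (p′ , q′) =
  (λ i → let j , e = p i ; k , e′ = p′ j in k , ≈-trans e e′) ,
  (λ k → let j , e′ = q′ k ; i , e = q j in i , ≈-trans e e′)

ϵ-respˡ : ∀ {a b c} → a ≈ b → a ϵ c → b ϵ c
ϵ-respˡ {c = set I f} e (i , e′) = i , ≈-trans (≈-sym e) e′

ϵ-respʳ : ∀ {a b c} → b ≈ c → a ϵ b → a ϵ c
ϵ-respʳ {b = set I f} {set J g} (p , _) (i , e) = let j , e′ = p i in j , ≈-trans e e′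

-- Zermelo's numerals: the successor of a numeral is its singleton.
numeral : ℕ → 𝕍
numeral zero    = set ⊥ λ ()
numeral (suc n) = set ⊤ λ _ → numeral n

numeral-injective : ∀ m n → numeral m ≈ numeral n → m ≡ n
numeral-injective zero    zero    _       = refl
numeral-injective zero    (suc n) (_ , q) = ⊥-elim (proj₁ (q tt))
numeral-injective (suc m) zero    (p , _) = ⊥-elim (proj₁ (p tt))
numeral-injective (suc m) (suc n) (p , _) = cong suc (numeral-injective m n (proj₂ (p tt)))

-- A prefix code of terms by binary words, which are the elements of ℕᵇ: the
-- second argument is the rest of the word.
private
  pattern `0 w = 2[1+_] w
  pattern `1 w = 1+[2_] w

unary : ℕ → ℕᵇ → ℕᵇ
unary zero    w = `0 w
unary (suc n) w = `1 (unary n w)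

word : ∀ {n} → Tm n → ℕᵇ → ℕᵇ
word (fvar x)    w = `0 (`0 (unary x w))
word (bvar i)    w = `0 (`1 (`0 (unary (toℕ i) w)))
word (sort type) w = `0 (`1 (`1 (`0 w)))
word (sort kind) w = `0 (`1 (`1 (`1 w)))
word (pi A B)    w = `1 (`0 (word A (word B w)))
word (lam A t)   w = `1 (`1 (`0 (word A (word t w))))
word (app t u)   w = `1 (`1 (`1 (word t (word u w))))

`0-injective : ∀ {v w} → 2[1+ v ] ≡ 2[1+ w ] → v ≡ w
`0-injective refl = refl

`1-injective : ∀ {v w} → 1+[2 v ] ≡ 1+[2 w ] → v ≡ w
`1-injective refl = refl

unary-injective : ∀ m n {v w} → unary m v ≡ unary n w → m ≡ n × v ≡ w
unary-injective zero    zero    refl = refl , refl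
unary-injective (suc m) (suc n) e with refl , e′ ← unary-injective m n (`1-injective e) = refl , e′

word-injective : ∀ {n} (t u : Tm n) {v w} → word t v ≡ word u w → t ≡ u × v ≡ w
word-injective (fvar x) (fvar y) e
  with refl , e′ ← unary-injective x y (`0-injective (`0-injective e)) = refl , e′
word-injective (bvar i) (bvar j) e
  with i≡j , e′ ← unary-injective (toℕ i) (toℕ j) (`0-injective (`1-injective (`0-injective e))) =
  cong bvar (toℕ-injective i≡j) , e′
word-injective (sort type) (sort type) refl = refl , refl
word-injective (sort kind) (sort kind) refl = refl , refl
word-injective (pi A B) (pi C D) e
  with refl , e′ ← word-injective A C (`0-injective (`1-injective e))
  with refl , e″ ← word-injective B D e′ = refl , e″
word-injective (lam A t) (lam C u) e
  with refl , e′ ← word-injective A C (`0-injective (`1-injective (`1-injective e)))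
  with refl , e″ ← word-injective t u e′ = refl , e″
word-injective (app t u) (app t′ u′) e
  with refl , e′ ← word-injective t t′ (`1-injective (`1-injective (`1-injective e)))
  with refl , e″ ← word-injective u u′ e′ = refl , e″
word-injective (fvar _)  (sort type) ()
word-injective (fvar _)  (sort kind) ()
word-injective (bvar _)  (sort type) ()
word-injective (bvar _)  (sort kind) ()
word-injective (pi _ _)  (sort type) ()
word-injective (pi _ _)  (sort kind) ()
word-injective (lam _ _) (sort type) ()
word-injective (lam _ _) (sort kind) ()
word-injective (app _ _) (sort type) ()
word-injective (app _ _) (sort kind) ()

-- Injectivity up to `≈` makes two candidates equal as sets of `𝕍` exactly when they have the same
-- terms.
code : Term → 𝕍
code t = numeral (ℕᵇ-toℕ (word t zeroᵇ))

code-injective : ∀ {t u} → code t ≈ code u → t ≡ u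
code-injective {t} {u} e = proj₁ (word-injective t u (ℕᵇ-toℕ-injective (numeral-injective _ _ e)))

-- Reducibility candidates

-- Accessibility supports induction along reductions, and the absence of infinite sequences follows
-- from it.
SN : Term → Set
SN = Acc (flip _⟶β_)

SN⇒StronglyTerminates : ∀ {t} → SN t → StronglyTerminates t
SN⇒StronglyTerminates (acc rs) (s , refl , steps) =
  SN⇒StronglyTerminates (rs (steps 0)) (s ∘ suc , refl , steps ∘ suc)

SN-app₁ : ∀ {t u} → SN (app t u) → SN t
SN-app₁ (acc rs) = acc (SN-app₁ ∘ rs ∘ app₁)

Step-inst : ∀ {x} {t t′ : Term} u → t ⟶β t′ → inst u (abs x t) ⟶β inst u (abs x t′)
Step-inst {x} {t} {t′} u t⟶t′
  rewrite inst-abs u x t | inst-abs u x t′ | /≡≔ x t u | /≡≔ x t′ u =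
  Step-⟪⟫ {[]} {[]} (λ _ → β-⟪⟫) (λ ()) t⟶t′

-- It is enough that one instance of the body terminates, since β is stable
-- under substitution.
SN-pi : ∀ {A T u} → SN A → SN (inst u T) → SN (pi A T)
SN-pi {u = u} A-sn T-sn = go A-sn T-sn refl
  where
  go : ∀ {A T v} → SN A → SN v → v ≡ inst u T → SN (pi A T)
  go {A} {T} {v} (acc as) (acc ts) refl = acc λ
    { (pi₁ _ p) → go (as p) (acc ts) refl
    ; (pi₂ _ p) → go (acc as) (ts (Step-inst u p)) refl }

SN-lam : ∀ {A T u} → SN A → SN (inst u T) → SN (lam A T)
SN-lam {u = u} A-sn T-sn = go A-sn T-sn refl
  where
  go : ∀ {A T v} → SN A → SN v → v ≡ inst u T → SN (lam A T)
  go {A} {T} {v} (acc as) (acc ts) refl = acc λ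
    { (lam₁ _ p) → go (as p) (acc ts) refl
    ; (lam₂ _ p) → go (acc as) (ts (Step-inst u p)) refl }

-- Applying a neutral term creates no redex at the root. Redexes are themselves neutral, so
-- `expands` applies to them.
data Neutral : Term → Set where
  fvar : ∀ {x} → Neutral (fvar x)
  app  : ∀ {t u} → Neutral (app t u)

-- Girard's conditions CR1, CR2 and CR3.
record IsCandidate (P : Term → Set) : Set where
  field
    terminates : ∀ {t} → P t → SN t
    reduces    : ∀ {t u} → P t → t ⟶β u → P u
    expands    : ∀ {t} → Neutral t → (∀ {u} → t ⟶β u → P u) → P t

  contains-fvar : ∀ x → P (fvar x)
  contains-fvar x = expands fvar λ { (root ()) }

open IsCandidate

SN-isCandidate : IsCandidate SN
SN-isCandidate = record
  { terminates = id
  ; reduces    = λ { (acc rs) → rs }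
  ; expands    = λ _ rs → acc rs
  }

-- Candidates are Boolean-valued, so that they form a small type.
Candidate : Set
Candidate = ∃ λ (f : Term → Bool) → IsCandidate (T ∘ f)

infix 4 _∈ᶜ_
_∈ᶜ_ : Term → Candidate → Set
t ∈ᶜ (f , _) = T (f t)

candidate-set : 𝕍
candidate-set = set Candidate λ c → set (∃ (_∈ᶜ c)) (code ∘ proj₁)

elem-⊆ : ∀ {a b t} → Eq candidate-set a b → t ∈ᶜ a → t ∈ᶜ b
elem-⊆ {b = b} {t} (p , _) t∈a =
  let (u , u∈b) , e = p (t , t∈a) in subst (_∈ᶜ b) (sym (code-injective e)) u∈b

elem-≈ : ∀ {a b} → (∀ {t} → t ∈ᶜ a → t ∈ᶜ b) → (∀ {t} → t ∈ᶜ b → t ∈ᶜ a) → Eq candidate-set a b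
elem-≈ a⊆b b⊆a =
  (λ { (t , t∈a) → (t , a⊆b t∈a) , ≈-refl (code t) }) ,
  (λ { (t , t∈b) → (t , b⊆a t∈b) , ≈-refl (code t) })

Arrow : Candidate → Subset candidate-set → Term → Set
Arrow a S t = ∀ u → u ∈ᶜ a → ∀ b → pred S b → app t u ∈ᶜ b

-- Termination comes from applying `t` to a variable, which lies in `a`, and landing in some member
-- of `S`; this needs `S` non-empty. For expansion, a neutral `t` is no abstraction, so `app t u`
-- reduces only inside `t` or `u`, and induction on the termination of `u` settles the second case.
Arrow-isCandidate : ∀ a S → Nonempty S → IsCandidate (Arrow a S)
Arrow-isCandidate (f , a-cand) S (b₀ , b₀∈S) = record
  { terminates = λ t∈ → SN-app₁ (terminates (proj₂ b₀) (t∈ (fvar 0) (contains-fvar a-cand 0) b₀ b₀∈S))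
  ; reduces    = λ t∈ p u u∈a b b∈S → reduces (proj₂ b) (t∈ u u∈a b b∈S) (app₁ p)
  ; expands    = λ t-neutral ts u u∈a b b∈S → go t-neutral ts u u∈a (terminates a-cand u∈a) b b∈S
  }
  where
  a : Candidate
  a = f , a-cand
  go : ∀ {t} → Neutral t → (∀ {t′} → t ⟶β t′ → Arrow a S t′) →
       ∀ u → u ∈ᶜ a → SN u → ∀ b → pred S b → app t u ∈ᶜ b
  go t-neutral ts u u∈a (acc us) b b∈S = expands (proj₂ b) app λ
    { (root beta) → case-lam t-neutral
    ; (app₁ p)    → ts p u u∈a b b∈S
    ; (app₂ p)    → go t-neutral ts _ (reduces a-cand u∈a p) (us p) b b∈S }
    where
    case-lam : ∀ {A t} {P : Set} → Neutral (lam A t) → P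
    case-lam ()

-- The redex is neutral, so its reducts suffice: the contractum, and reductions inside the
-- abstraction or the argument, handled by induction on the termination of both. Closure of `b`
-- under reduction carries the hypothesis along when the body changes.
lam-∈ : ∀ a b {A t} → SN (lam A t) → (∀ {u} → u ∈ᶜ a → inst u t ∈ᶜ b) →
        ∀ {u} → u ∈ᶜ a → app (lam A t) u ∈ᶜ b
lam-∈ a b lam-sn inst∈b u∈a = go lam-sn inst∈b (terminates (proj₂ a) u∈a) u∈a
  where
  go : ∀ {A t} → SN (lam A t) → (∀ {u} → u ∈ᶜ a → inst u t ∈ᶜ b) →
       ∀ {u} → SN u → u ∈ᶜ a → app (lam A t) u ∈ᶜ b
  go (acc ls) inst∈b {u} (acc us) u∈a = expands (proj₂ b) app λ
    { (root (beta {x} {t = t})) → subst (_∈ᶜ b) (inst-abs u x t) (inst∈b u∈a)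
    ; (app₁ (lam₁ {t = t} x∉ p)) → go (ls (lam₁ {t = t} x∉ p)) inst∈b (acc us) u∈a
    ; (app₁ (lam₂ {x} {t = t} x∉ p)) →
        go (ls (lam₂ {t = t} x∉ p))
           (λ v∈a → reduces (proj₂ b) (inst∈b v∈a) (Step-inst {x} {t} _ p)) (acc us) u∈a
    ; (app₂ p) → go (acc ls) inst∈b (us p) (reduces (proj₂ a) u∈a p) }

-- The full, ordered and complete Π-algebra of candidates

module CandidateAlgebra (em : ExcludedMiddle 0ℓ) where

  ⌈_⌉ : ∀ {P} → IsCandidate P → Candidate
  ⌈_⌉ {P} P-cand = (λ t → ⌊ em {P t} ⌋) , record
    { terminates = terminates P-cand ∘ toWitness
    ; reduces    = λ t∈ p → fromWitness (reduces P-cand (toWitness t∈) p)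
    ; expands    = λ t-neutral ts → fromWitness (expands P-cand t-neutral (toWitness ∘ ts))
    }

  ∈⌈⌉⁺ : ∀ {P} (P-cand : IsCandidate P) {t} → P t → t ∈ᶜ ⌈ P-cand ⌉
  ∈⌈⌉⁺ _ = fromWitness

  ∈⌈⌉⁻ : ∀ {P} (P-cand : IsCandidate P) {t} → t ∈ᶜ ⌈ P-cand ⌉ → P t
  ∈⌈⌉⁻ _ = toWitness

  arrow : Candidate → (S : Subset candidate-set) → Nonempty S → Candidate
  arrow a S S≢∅ = ⌈ Arrow-isCandidate a S S≢∅ ⌉

  -- The pre-order relates any two candidates, so that ∧̃ can be arbitrary.
  algebra : ΠAlgebra
  algebra = record
    { 𝓑          = candidate-set
    ; _≲_        = λ _ _ → ⊤
    ; ⊤̃          = ⌈ SN-isCandidate ⌉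
    ; _∧̃_        = λ a _ → a
    ; 𝒜          = Nonempty
    ; Π̃          = arrow
    ; 𝒜-resp     = λ { (S⊆T , _) (a , a∈S) → a , S⊆T a∈S }
    ; ∧̃-cong     = λ a≈b _ → a≈b
    ; Π̃-cong     = λ {a} {b} {S} {T} p q a≈b (S⊆T , T⊆S) → elem-≈ {arrow a S p} {arrow b T q}
        (λ t∈ → ∈⌈⌉⁺ (Arrow-isCandidate b T q) λ u u∈b c c∈T →
          ∈⌈⌉⁻ (Arrow-isCandidate a S p) t∈ u (elem-⊆ {b} {a} (≈-sym a≈b) u∈b) c (T⊆S c∈T))
        (λ t∈ → ∈⌈⌉⁺ (Arrow-isCandidate a S p) λ u u∈a c c∈S →
          ∈⌈⌉⁻ (Arrow-isCandidate b T q) t∈ u (elem-⊆ {a} {b} a≈b u∈a) c (S⊆T c∈S))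
    ; 𝒜⊆𝒫⁺       = id
    ; isPreorder = record
        { isEquivalence = record { refl = ≈-refl _ ; sym = ≈-sym ; trans = ≈-trans }
        ; reflexive     = λ _ → tt
        ; trans         = λ _ _ → tt
        }
    ; ⊤̃-max      = λ _ → tt
    ; ∧̃-inf      = λ _ _ → tt , tt , λ _ _ _ → tt
    ; Π̃-adj      = λ _ _ _ → mk⇔ (λ _ _ _ → tt) (λ _ → tt)
    }

  algebra-full : Full algebra
  algebra-full _ = id

  -- The order has to be reverse inclusion.  Since S ⊑ₛ T only asks each element
  -- of S to lie below some element of T, the intersection over T may be smaller
  -- than that over S, and Π̃ is not monotone for inclusion.
  algebra-ordering : Ordering algebra
  algebra-ordering = record
    { _⊑_            = λ a b → ∀ {t} → t ∈ᶜ b → t ∈ᶜ a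
    ; isPartialOrder = record
        { isPreorder = record
            { isEquivalence = record { refl = ≈-refl _ ; sym = ≈-sym ; trans = ≈-trans }
            ; reflexive     = λ {a} {b} a≈b → elem-⊆ {b} {a} (≈-sym a≈b)
            ; trans         = λ b⊆a c⊆b → b⊆a ∘ c⊆b
            }
        ; antisym    = λ {a} {b} b⊆a a⊆b → elem-≈ {a} {b} a⊆b b⊆a
        }
    ; Π̃-antitone     = λ {a} {b} {S} p b⊆a t∈ → ∈⌈⌉⁺ (Arrow-isCandidate b S p) λ u u∈b c c∈S →
        ∈⌈⌉⁻ (Arrow-isCandidate a S p) t∈ u (b⊆a u∈b) c c∈S
    ; Π̃-monotone     = λ {a} {S} {T} p q S⊑T t∈ → ∈⌈⌉⁺ (Arrow-isCandidate a S p) λ u u∈a c c∈S →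
        let d , d∈T , d⊆c = S⊑T c c∈S in
        d⊆c (∈⌈⌉⁻ (Arrow-isCandidate a T q) t∈ u u∈a d d∈T)
    }

  -- Least upper bounds for reverse inclusion are intersections. The conjunct `SN t` covers the
  -- empty `S`, whose bound is the largest candidate.
  Meet : Subset candidate-set → Term → Set
  Meet S t = SN t × (∀ a → pred S a → t ∈ᶜ a)

  Meet-isCandidate : ∀ S → IsCandidate (Meet S)
  Meet-isCandidate S = record
    { terminates = proj₁
    ; reduces    = λ { (acc rs , t∈) p → rs p , λ a a∈S → reduces (proj₂ a) (t∈ a a∈S) p }
    ; expands    = λ t-neutral ts → acc (proj₁ ∘ ts) ,
        λ a a∈S → expands (proj₂ a) t-neutral λ p → proj₂ (ts p) a a∈S
    }

  algebra-complete : Complete algebra-ordering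
  algebra-complete S = ⌈ Meet-isCandidate S ⌉ ,
    (λ a a∈S t∈ → proj₂ (∈⌈⌉⁻ (Meet-isCandidate S) t∈) a a∈S) ,
    (λ c c⊇ t∈c → ∈⌈⌉⁺ (Meet-isCandidate S) (terminates (proj₂ c) t∈c , λ a a∈S → c⊇ a a∈S t∈c))

-- Valuations

-- Updated x φs cs ψs is ψs = φs [ x ↦ cs ] up to ≈.  The tail of an update is an
-- update of the tail only up to pointwise equality, because the local function
-- of _[_↦_] depends on the whole tuple.
data Updated (x : Var) : ∀ {k} → Valuations k → Vec 𝕍 k → Valuations k → Set₁ where
  []  : Updated x [] [] []
  _∷_ : ∀ {k φ ψ c} {φs ψs : Valuations k} {cs} →
        (ψ x ≈ c) × (∀ {y} → x ≢ y → ψ y ≈ φ y) →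
        Updated x φs cs ψs → Updated x (φ ∷ φs) (c ∷ cs) (ψ ∷ ψs)

zipWith-updated : ∀ {x k f} → (∀ φ c → f φ c x ≈ c) → (∀ φ c {y} → x ≢ y → f φ c y ≈ φ y) →
                  (φs : Valuations k) (cs : Vec 𝕍 k) → Updated x φs cs (zipWith f φs cs)
zipWith-updated same other []       []       = []
zipWith-updated same other (φ ∷ φs) (c ∷ cs) =
  (same φ c , other φ c) ∷ zipWith-updated same other φs cs

-- As for /≡≔, the local function of _[_↦_] is inferred from ↦-updated.
mutual
  ↦-updated : ∀ {k} (φs : Valuations k) x cs → Updated x φs cs (φs [ x ↦ cs ])
  ↦-updated φs x cs = zipWith-updated (update-same φs x cs) (update-other φs x cs) φs cs

  update-same : ∀ {k} (φs : Valuations k) x cs → ∀ φ c → _ ≈ c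
  update-same φs x cs φ c with x ≟ x
  ... | yes _  = ≈-refl c
  ... | no x≢x = ⊥-elim (x≢x refl)

  update-other : ∀ {k} (φs : Valuations k) x cs → ∀ φ c {y} → x ≢ y → _ ≈ φ y
  update-other φs x cs φ c {y} x≢y with x ≟ y
  ... | yes x≡y = ⊥-elim (x≢y x≡y)
  ... | no _    = ≈-refl (φ y)

Updated-other : ∀ {x y k} {φs ψs : Valuations k} {cs} → Updated x φs cs ψs → x ≢ y →
                Pointwise (λ ψ φ → ψ y ≈ φ y) ψs φs
Updated-other []              x≢y = []
Updated-other ((_ , o) ∷ upd) x≢y = o x≢y ∷ Updated-other upd x≢y

On-tail : ∀ {𝒟 k Γ x A} (φs : Valuations k) → On 𝒟 (Γ ▸ x ∶ A) φs → On 𝒟 Γ φs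
On-tail []       _          = tt
On-tail (φ ∷ φs) (on , φ-on) = On-tail φs on , φ-on ∘ there

module ModelProperties {Σ : Context} {ℛ : Rules} (theory : IsTheory Σ ℛ)
                       (ℳ : Semantics.Model Σ ℛ) where
  open Calculus Σ ℛ
  open Metatheory theory
  open Semantics Σ ℛ
  open Model ℳ

  unchanged : ∀ {k Γ x A B s} {φs ψs : Valuations k} {cs} → k ≤ suc m →
              x ∉ dom (Γ ++ Σ) → Γ ⊢ B ∶ sort s → Updated x φs cs ψs →
              On 𝒟 Γ φs → On 𝒟 (Γ ▸ x ∶ A) ψs → 𝒟 k B ψs ≈ 𝒟 k B φs
  unchanged {ψs = ψs} k≤ x∉ ⊢B upd φs-on ψs-on =
    local k≤ (inj₁ (_ , ⊢B)) (inj₁ (_ , ⊢B)) (On-tail ψs ψs-on) φs-on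
      λ y y∈ _ → Updated-other upd λ { refl → x∉ (fv-⊢ ⊢B y∈) }

  -- The set in which a valuation takes its values depends on the preceding valuations, which the
  -- update changes too; `unchanged` carries the memberships across, by induction along the tuple.
  Updated-on : ∀ {k Γ x A} {φs ψs : Valuations k} {cs} → k ≤ suc m →
               WellFormed (Γ ▸ x ∶ A) → Updated x φs cs ψs →
               On 𝒟 Γ φs → Elements 𝒟 A φs cs → On 𝒟 (Γ ▸ x ∶ A) ψs
  Updated-on k≤ Γ-wf [] _ _ = tt
  Updated-on {suc k} {Γ} {x} {A} {φ ∷ φs} {ψ ∷ ψs} k≤ Γ-wf@(decl ⊢A x∉) ((same , other) ∷ upd)
             (φs-on , φ-on) (cs-in , c-in) = ψs-on , ψ-on
    where
    k≤′ : k ≤ suc m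
    k≤′ = m≤n⇒m≤1+n (s≤s⁻¹ k≤)
    ψs-on : On 𝒟 (Γ ▸ x ∶ A) ψs
    ψs-on = Updated-on k≤′ Γ-wf upd φs-on cs-in
    keep : ∀ {B s} → Γ ⊢ B ∶ sort s → 𝒟 k B φs ≈ 𝒟 k B ψs
    keep ⊢B = ≈-sym (unchanged k≤′ x∉ ⊢B upd φs-on ψs-on)
    ψ-on : ∀ {y B} → (y , B) ∈ (Γ ▸ x ∶ A) → ψ y ϵ 𝒟 k B ψs
    ψ-on (here refl) = ϵ-respʳ (keep ⊢A) (ϵ-respˡ {c = 𝒟 k A φs} (≈-sym same) c-in)
    ψ-on {y} {B} (there y∈) =
      ϵ-respʳ (keep (proj₂ (declaration-sorted (wf ⊢A) (∈-++⁺ˡ y∈))))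
        (ϵ-respˡ {c = 𝒟 k B φs}
          (≈-sym (other λ { refl → x∉ (∈-map⁺ proj₁ (∈-++⁺ˡ y∈)) })) (φ-on y∈))

  values-in : ∀ {k Γ u A} (φs : Valuations k) → k ≤ suc m →
              Γ ⊢ u ∶ A → On 𝒟 Γ φs → Elements 𝒟 A φs (values 𝒟 u φs)
  values-in []       k≤ ⊢u _             = tt
  values-in (φ ∷ φs) k≤ ⊢u on@(φs-on , _) =
    values-in φs (m≤n⇒m≤1+n (s≤s⁻¹ k≤)) ⊢u φs-on , typed (s≤s⁻¹ k≤) ⊢u on

  elements-exist : ∀ {k Γ A s} (φs : Valuations k) → k ≤ suc m →
                   Γ ⊢ A ∶ sort s → On 𝒟 Γ φs → ∃[ cs ] Elements 𝒟 A φs cs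
  elements-exist []       k≤ ⊢A _           = [] , tt
  elements-exist (φ ∷ φs) k≤ ⊢A (φs-on , _) =
    let cs , cs-in = elements-exist φs (m≤n⇒m≤1+n (s≤s⁻¹ k≤)) ⊢A φs-on
        c , c-in   = inhabited (s≤s⁻¹ k≤) ⊢A φs-on
    in c ∷ cs , cs-in , c-in

  ↦-on : ∀ {Γ x A} {φs : Valuations (suc m)} {cs} → WellFormed (Γ ▸ x ∶ A) →
         On 𝒟 Γ φs → Elements 𝒟 A φs cs → On 𝒟 (Γ ▸ x ∶ A) (φs [ x ↦ cs ])
  ↦-on {x = x} {φs = φs} {cs} Γ-wf = Updated-on ≤-refl Γ-wf (↦-updated φs x cs)

  valuations-exist : ∀ {Γ} → WellFormed Γ → ∃[ φs ] On 𝒟 {suc m} Γ φs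
  -- No variable is constrained here, so the empty set is an arbitrary default.
  valuations-exist empty = replicate _ (λ _ → set ⊥ λ ()) , on (suc m)
    where
    on : ∀ k → On 𝒟 [] (replicate k (λ _ → set ⊥ λ ()))
    on zero    = tt
    on (suc k) = on k , λ ()
  valuations-exist Γ-wf@(decl {x = x} ⊢A _) =
    let φs , φs-on = valuations-exist (wf ⊢A)
        cs , cs-in = elements-exist φs ≤-refl ⊢A φs-on
    in φs [ x ↦ cs ] , ↦-on Γ-wf φs-on cs-in

-- Soundness

infix 4 _⊨_
-- Values of the model are candidates only up to `≈`; `⊨⇒∈` shows that the choice of the
-- representing candidate does not matter.
_⊨_ : Term → 𝕍 → Set
t ⊨ v = ∃[ c ] (v ≈ elem candidate-set c × t ∈ᶜ c)

⊨-resp : ∀ {t v w} → v ≈ w → t ⊨ v → t ⊨ w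
⊨-resp v≈w (c , v≈c , t∈c) = c , ≈-trans (≈-sym v≈w) v≈c , t∈c

⊨⇒∈ : ∀ {t v c} → v ≈ elem candidate-set c → t ⊨ v → t ∈ᶜ c
⊨⇒∈ {c = c} v≈c (d , v≈d , t∈d) = elem-⊆ {d} {c} (≈-trans (≈-sym v≈d) v≈c) t∈d

⊨⇒SN : ∀ {t v} → t ⊨ v → SN t
⊨⇒SN (c , _ , t∈c) = IsCandidate.terminates (proj₂ c) t∈c

module Soundness {Σ : Context} {ℛ : Rules} (em : ExcludedMiddle 0ℓ) (theory : IsTheory Σ ℛ)
                 (super : Semantics.SuperConsistent Σ ℛ) where
  open Calculus Σ ℛ
  open Metatheory theory
  open Semantics Σ ℛ
  open CandidateAlgebra em

  private
    model = super algebra algebra-full algebra-ordering algebra-complete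
    ℳ = proj₁ model
  open Model ℳ
  open ValuedIn (proj₁ (proj₂ model))
  open ModelsTheory (proj₂ (proj₂ model))
  open ModelProperties theory ℳ

  -- The typing condition at the last level places the value of `A` in that of its sort one level
  -- below, which is the carrier of the algebra.
  interpretation : ∀ {Γ A s φs} → Γ ⊢ A ∶ sort s → On 𝒟 Γ φs →
                   ∃[ c ] (⟦ A ⟧ φs ≈ elem candidate-set c)
  interpretation {s = s} {φ ∷ φs} ⊢A on = ϵ-respʳ (𝒟-sort s) (typed ≤-refl ⊢A on)
    where
    𝒟-sort : ∀ s → 𝒟 m (sort s) φs ≈ candidate-set
    𝒟-sort type = 𝒟-Type φs
    𝒟-sort kind = 𝒟-Kind φs

  SN⇒⊨sort : ∀ s φs {t} → SN t → t ⊨ ⟦ sort s ⟧ φs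
  SN⇒⊨sort type φs t-sn = ⌈ SN-isCandidate ⌉ , ⟦Type⟧ φs , ∈⌈⌉⁺ SN-isCandidate t-sn
  SN⇒⊨sort kind φs t-sn = ⌈ SN-isCandidate ⌉ , ⟦Kind⟧ φs , ∈⌈⌉⁺ SN-isCandidate t-sn

  -- Constants are variables too, so this realizes them as well as the identity substitution.
  fvar-⊨ : ∀ {Γ A s φs} x → Γ ⊢ A ∶ sort s → On 𝒟 Γ φs → fvar x ⊨ ⟦ A ⟧ φs
  fvar-⊨ x ⊢A on = let c , e = interpretation ⊢A on in
    c , e , IsCandidate.contains-fvar (proj₂ c) x

  Realizes : Context → Valuations (suc m) → Substitution → Set
  Realizes Γ φs σ = ∀ {x A} → (x , A) ∈ Γ → σ x ⊨ ⟦ A ⟧ φs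

  extend-realizer : ∀ {Γ x A φs cs σ u} → WellFormed (Γ ▸ x ∶ A) → On 𝒟 Γ φs →
                    Elements 𝒟 A φs cs → Realizes Γ φs σ → u ⊨ ⟦ A ⟧ φs →
                    Realizes (Γ ▸ x ∶ A) (φs [ x ↦ cs ]) (σ ⟨ x ≔ u ⟩)
  extend-realizer {Γ} {x} {A} {φs} {cs} {σ} {u} Γ-wf@(decl ⊢A x∉) on cs-in σ⊨ u⊨ = realizes
    where
    keep : ∀ {B s} → Γ ⊢ B ∶ sort s → ⟦ B ⟧ φs ≈ ⟦ B ⟧ (φs [ x ↦ cs ])
    keep ⊢B = ≈-sym (unchanged ≤-refl x∉ ⊢B (↦-updated φs x cs) on (↦-on Γ-wf on cs-in))
    realizes : Realizes (Γ ▸ x ∶ A) (φs [ x ↦ cs ]) (σ ⟨ x ≔ u ⟩)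
    realizes (here refl) rewrite ≔-same σ x u = ⊨-resp (keep ⊢A) u⊨
    realizes {y} (there y∈)
      rewrite ≔-other σ {x} {y} u (λ { refl → x∉ (∈-map⁺ proj₁ (∈-++⁺ˡ y∈)) }) =
      ⊨-resp (keep (proj₂ (declaration-sorted (wf ⊢A) (∈-++⁺ˡ y∈)))) (σ⊨ y∈)

  sound : ∀ {Γ t A φs σ} → Γ ⊢ t ∶ A → On 𝒟 Γ φs → σ Fixes dom Σ → Realizes Γ φs σ →
          t ⟪ σ ⟫ ⊨ ⟦ A ⟧ φs

  -- The realizer `u` and the semantic values `cs` of `x` are chosen independently, and this matches
  -- `Arrow`, where the argument and the member of `S` are quantified separately.
  sound-body : ∀ {Γ x A t B φs cs σ u} → Γ ▸ x ∶ A ⊢ t ∶ B → On 𝒟 Γ φs → σ Fixes dom Σ →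
               Realizes Γ φs σ → Elements 𝒟 A φs cs → u ⊨ ⟦ A ⟧ φs →
               inst u (abs x t ⟪ σ ⟫) ⊨ ⟦ B ⟧ (φs [ x ↦ cs ])

  sound {φs = φs} (sort-rule _) on σ-fix σ⊨ = SN⇒⊨sort kind φs (acc λ { (root ()) })
  sound {Γ} {φs = φs} {σ} (variable-rule {x = x} {A} Γ-wf x∈) on σ-fix σ⊨ =
    subst (_⊨ ⟦ A ⟧ φs) (sym (weaken-0 (σ x))) (go (∈-++⁻ Γ x∈))
    where
    go : (x , A) ∈ Γ ⊎ (x , A) ∈ Σ → σ x ⊨ ⟦ A ⟧ φs
    go (inj₁ x∈Γ) = σ⊨ x∈Γ
    go (inj₂ x∈Σ) rewrite σ-fix (∈-map⁺ proj₁ x∈Σ) =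
      fvar-⊨ x (proj₂ (declaration-sorted Γ-wf x∈)) on
  sound {φs = φs} (product {s = s} ⊢A ⊢B) on σ-fix σ⊨ =
    -- One instance of the body suffices for `SN-pi`: any semantic elements of the domain, with the
    -- variable `0` as realizer.
    let cs , cs-in = elements-exist φs ≤-refl ⊢A on
    in SN⇒⊨sort s φs (SN-pi (⊨⇒SN (sound ⊢A on σ-fix σ⊨))
         (⊨⇒SN (sound-body ⊢B on σ-fix σ⊨ cs-in (fvar-⊨ 0 ⊢A on))))
  sound {φs = φs} {σ} (abstraction {x = x} {A} {B} {t} ⊢A ⊢B ⊢t) on σ-fix σ⊨
    with a , S , S≢∅ , A≈a , S-values , Π≈ ← ⟦Π⟧ ⊢A ⊢B on =
    arrow a S S≢∅ , Π≈ , ∈⌈⌉⁺ (Arrow-isCandidate a S S≢∅)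
      λ u u∈a b b∈S → lam-∈ a b lam-SN (body b∈S) u∈a
    where
    body : ∀ {b u} → pred S b → u ∈ᶜ a → inst u (abs x t ⟪ σ ⟫) ∈ᶜ b
    body {b} b∈S u∈a with cs , cs-in , B≈b ← Equivalence.to (S-values b) b∈S =
      ⊨⇒∈ {c = b} B≈b (sound-body ⊢t on σ-fix σ⊨ cs-in (a , A≈a , u∈a))
    lam-SN : SN (lam (A ⟪ σ ⟫) (abs x t ⟪ σ ⟫))
    lam-SN = let b , b∈S = S≢∅ in
      SN-lam (⊨⇒SN (sound ⊢A on σ-fix σ⊨))
        (IsCandidate.terminates (proj₂ b)
          (body b∈S (IsCandidate.contains-fvar (proj₂ a) 0)))
  -- The name x of the bound variable may already be declared in Γ, so the clause
  -- for products is applied to the name y and the body C given by inversion.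
  sound {Γ} {φs = φs} {σ} (application {x = x} {A} {B} {t} {u} ⊢t ⊢u) on σ-fix σ⊨
    with sorted ⊢Π ← type-of ⊢t
    with y , C , s , B≡C , ⊢A , ⊢C ← Π-inversion ⊢Π
    with sound ⊢t on σ-fix σ⊨
  ... | t⊨ rewrite sym (inst-abs u x B) | B≡C | inst-abs u y C
    with a , S , S≢∅ , A≈a , S-values , Π≈ ← ⟦Π⟧ ⊢A ⊢C on
    with b , C≈b ← interpretation (⊢-/ ⊢C ⊢u) on =
    b , C≈b ,
    ∈⌈⌉⁻ (Arrow-isCandidate a S S≢∅) (⊨⇒∈ {c = arrow a S S≢∅} Π≈ t⊨) (u ⟪ σ ⟫)
      (⊨⇒∈ {c = a} A≈a (sound ⊢u on σ-fix σ⊨)) b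
      -- The value of the substituted codomain is a member of `S`: by the substitution property it
      -- is the value of `C` at the tuple which `u` determines.
      (Equivalence.from (S-values b)
        (values 𝒟 u φs , values-in φs ≤-refl ⊢u on ,
         ≈-trans (≈-sym (substitution (inj₁ (_ , ⊢C)) ⊢u on)) C≈b))
  sound (conversion ⊢A ⊢B ⊢t A≡B) on σ-fix σ⊨ =
    ⊨-resp (congruence ≤-refl (_ , ⊢A) (_ , ⊢B) A≡B on) (sound ⊢t on σ-fix σ⊨)

  sound-body {Γ} {x} {t = t} {φs = φs} {cs} {σ} {u} ⊢t on σ-fix σ⊨ cs-in u⊨
    with Γ-wf@(decl _ x∉) ← wf ⊢t
    rewrite inst-abs-⟪⟫ u x σ t =
    sound ⊢t (↦-on Γ-wf on cs-in) (Fixes-≔ {σ} {x} σ-fix (x∉ ∘ dom-++⁺ʳ Γ))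
      (extend-realizer {σ = σ} Γ-wf on cs-in σ⊨ u⊨)

theorem5p1 :
    ExcludedMiddle 0ℓ →
    (Σ : Context) (ℛ : Rules) → IsTheory Σ ℛ →
    Confluent (Calculus._⟶βℛ_ Σ ℛ) →
    Calculus.SubjectReduction Σ ℛ →
    Semantics.SuperConsistent Σ ℛ →
    (Γ : Context) (t : Term) → Calculus.WellTyped Σ ℛ Γ t →
    StronglyTerminates t
theorem5p1 em Σ ℛ theory _ _ super Γ t (A , ⊢t) =
  let φs , on = valuations-exist (wf ⊢t)
      t⊨ = sound {σ = fvar} ⊢t on (λ _ → refl) λ {x} x∈ →
        fvar-⊨ x (proj₂ (declaration-sorted (wf ⊢t) (∈-++⁺ˡ x∈))) on
  in SN⇒StronglyTerminates (subst SN (⟪⟫-id t) (⊨⇒SN t⊨))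
  where
  open Metatheory theory
  open Soundness em theory super
  open ModelProperties theory (proj₁ (super _ _ _ _))
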